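{- Let $k\geq 2$ be an integer and let $G_l(q)$, $l\geq 1$, be the sequence of formal series defined in the context. Then for every $j\geq 0$ and every $i\in\{1,\dots,k\}$ there is a formal power series $\gamma(q)\in\mathbb{C}[[q]]$ such that $$G_{(k-1)j+i}(q)=1+q^{2j+1}\gamma(q).$$
   Context: $q$ is a formal variable and all series are formal (Laurent) series in $q$. Fix an integer $k\geq 2$. For $1\leq i\leq k$ define $$G_i(q)=\prod_{\substack{m\geq 1,\ m\not\equiv 2\ (\mathrm{mod}\ 4),\\ m\not\equiv 0,\ 2k+(2i-1),\ 2k-(2i-1)\ (\mathrm{mod}\ 4k)}}(1-q^m)^{ -1}.$$ Every integer $l\geq k+1$ can be written uniquely as $l=(k-1)j+i$ with $j\geq 1$ and $2\leq i\leq k$ (note $(k-1)j+1=(k-1)(j-1)+k$). For such $l$ define recursively $$G_{(k-1)j+i}(q)=\frac{G_{(k-1)(j-1)+k-i+1}(q)-G_{(k-1)(j-1)+k-i+2}(q)}{q^{2j(i-1)}}-q^{ -1}G_{(k-1)j+i-1}(q),$$ the right-hand side involving only indices smaller than $(k-1)j+i$. -}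

module Defs where

open import Data.Bool using (Bool; true; false; if_then_else_; not; _∧_)
open import Data.Nat as ℕ using (ℕ; zero; suc; _∸_; _≡ᵇ_)
open import Data.Nat.DivMod using (_%_; _/_)
open import Data.Integer as ℤ using (ℤ; +_; -[1+_]; _+_; _-_; _*_; -_)
open import Data.List using (List; upTo; map; foldr)

-- Formal power series with integer coefficients: n ↦ coefficient of q^n.
PS : Set
PS = ℕ → ℤ

-- Formal Laurent series (arbitrary ℤ-indexed coefficient families);
-- only ℤ-linear operations and multiplication by q^a are ever used on them.
LS : Set
LS = ℤ → ℤ

-- remainder / quotient with the convention that division by 0 is trivial
-- (never used with divisor 0 below since k ≥ 2).
modN : ℕ → ℕ → ℕ
modN m zero    = m
modN m (suc d) = m % suc d

divN : ℕ → ℕ → ℕ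
divN m zero    = 0
divN m (suc d) = m / suc d

sumℤ : List ℤ → ℤ
sumℤ = foldr _+_ (+ 0)

onePS : PS
onePS zero    = + 1
onePS (suc _) = + 0

mulPS : PS → PS → PS
mulPS f g n = sumℤ (map (λ a → f a * g (n ∸ a)) (upTo (suc n)))

-- (1 - q^m)^{-1} = Σ_{t ≥ 0} q^{m t}   (for m ≥ 1)
geomInv : ℕ → PS
geomInv m n = if modN n m ≡ᵇ 0 then + 1 else + 0

allowed : ℕ → ℕ → ℕ → Bool
allowed k i m =
  not (modN m 4 ≡ᵇ 2)
  ∧ not (r ≡ᵇ 0)
  ∧ not (r ≡ᵇ modN (2 ℕ.* k ℕ.+ (2 ℕ.* i ∸ 1)) (4 ℕ.* k))
  ∧ not (r ≡ᵇ modN (2 ℕ.* k ∸ (2 ℕ.* i ∸ 1)) (4 ℕ.* k))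
  where r = modN m (4 ℕ.* k)

finProd : ℕ → ℕ → ℕ → PS
finProd k i zero    = onePS
finProd k i (suc N) =
  mulPS (finProd k i N) (if allowed k i (suc N) then geomInv (suc N) else onePS)

-- the infinite product: its coefficient of q^n is that of the partial
-- product over m ≤ n (factors with m > n do not affect it)
prodPS : ℕ → ℕ → PS
prodPS k i n = finProd k i n n

fromPS : PS → LS
fromPS f (+ n)    = f n
fromPS f -[1+ _ ] = + 0

oneLS : LS
oneLS = fromPS onePS

zeroLS : LS
zeroLS _ = + 0

_+ᴸ_ : LS → LS → LS
(f +ᴸ g) n = f n + g n

_-ᴸ_ : LS → LS → LS
(f -ᴸ g) n = f n - g n

shiftL : ℤ → LS → LS
shiftL a f n = f (n - a)

Gbase : ℕ → ℕ → LS
Gbase k i = fromPS (prodPS k i)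

-- One "row" j+1 of the recursion: given prev i = G_{(k-1)j+i} (1 ≤ i ≤ k),
-- compute i ↦ G_{(k-1)(j+1)+i}.
row : ℕ → ℕ → (ℕ → LS) → ℕ → LS
row k j prev zero          = zeroLS
row k j prev (suc zero)    = prev k
row k j prev (suc (suc i')) =
  shiftL (- (+ (2 ℕ.* J ℕ.* (i ∸ 1))))
         (prev (k ∸ i ℕ.+ 1) -ᴸ prev (k ∸ i ℕ.+ 2))
  -ᴸ shiftL (- (+ 1)) (row k j prev (suc i'))
  where
  i = suc (suc i')
  J = suc j

-- level k j i = G_{(k-1)j+i}   for 1 ≤ i ≤ k
level : ℕ → ℕ → ℕ → LS
level k zero    = Gbase k
level k (suc j) = row k j (level k j)

G : ℕ → ℕ → LS
G k l = level k j (l ∸ (k ∸ 1) ℕ.* j)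
  where j = divN (l ∸ 2) (k ∸ 1)

{-# OPTIONS --safe #-}
-- By Jacobi's triple product, G_i = F · Σ_{μ ≥ 0} (-1)^μ (q^{2kμ²+(2i-1)μ} - q^{2k(μ+1)²-(2i-1)(μ+1)})
-- with F = Π_{m ≥ 1} (1 + q^{2m-1}) / (1 - q^{2m}).  The recursion preserves this shape: with (x)_j = (x; q²)_j,
--   G_{(k-1)j+i} = F · Σ_{μ ≥ 0} (-1)^μ (q^{2μ+2})_j / (-q^{2μ+1})_{j+1} · (q^α (1 + q^{2μ+2j+1}) - q^β (1 + q^{2μ+1})),
-- where α = 2kμ(μ+j) + (2i-1)μ and β = 2(μ+j+1)(kμ+k-i) + μ + 2j + 1.
-- All β, and all α with μ ≥ 1, are at least 2j + 1, so modulo q^{2j+1} only the leading part of the μ = 0 term is left: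
-- F (q²)_j / (-q)_j = Π_{m > j} (1 + q^{2m-1}) / (1 - q^{2m}) ≡ 1.
-- Infinite sums and products are avoided: every identity is proved modulo q^N, with sums and products cut off beyond N.
module Submission where

open import Defs
open import Algebra.Bundles using (CommutativeMonoid; CommutativeRing)
import Algebra.Solver.Ring
open import Algebra.Solver.Ring.AlmostCommutativeRing using (fromCommutativeRing; _-Raw-AlmostCommutative⟶_)
open import Data.Bool using (Bool; true; false; T; not; _∧_; if_then_else_)
open import Data.Integer as ℤ using (ℤ; +_; -[1+_]; ∣_∣)
import Data.Integer.Properties as ℤₚ
import Data.Integer.Solver as ℤ-Solver
open import Data.List.Properties using (map-applyUpTo)
open import Data.Maybe as Maybe using (Maybe)
open import Data.Nat as ℕ using (ℕ; zero; suc; _∸_; _≤_; _<_; z≤n; s≤s; _≡ᵇ_)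
open import Data.Nat.DivMod
open import Data.Nat.Divisibility using (divides-refl; m∣m*n)
import Data.Nat.Properties as ℕₚ
import Data.Nat.Solver as ℕ-Solver
open import Data.Nat.Tactic.RingSolver using (solve-∀)
open import Data.Product using (_,_; ∃-syntax)
open import Data.Sum using (_⊎_; inj₁; inj₂)
open import Level using (0ℓ; _⊔_)
open import Relation.Nullary using (¬_; contradiction)
open import Relation.Nullary.Decidable.Core using (dec⇒maybe)
open import Relation.Binary.PropositionalEquality as ≡ using (_≡_; _≗_)

-- A direct induction on the statement fails: for i ≥ 2 the recursion divides a difference of two
-- series known only modulo q^(2j+1) by q^(2(j+1)(i-1)), whose exponent is at least 2j + 2, so
-- nothing known survives the division. Every level must be known exactly, which is what the closed
-- form provides. The same division shapes the bookkeeping: one coefficient of a row needs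
-- coefficients of much higher index in the row before. So the closed form is compared with the
-- recursion modulo a q^M chosen after the coefficient index, and only the finished comparison is
-- read modulo q^(2j+1).

-- A ring solver with integer coefficients over any commutative ring.

module IntegerSolver {c ℓ} (R : CommutativeRing c ℓ) where
  open CommutativeRing R
  open import Algebra.Properties.Semiring.Mult.TCOptimised semiring using (_×_; 1+×; ×-homo-+; ×1-homo-*)
  open import Algebra.Properties.Ring ring using (-‿distribˡ-*; -‿distribʳ-*; -0#≈0#)
  open import Algebra.Properties.AbelianGroup +-abelianGroup using (⁻¹-∙-comm; ⁻¹-involutive)
  open import Relation.Binary.Reasoning.Setoid setoid

  ⟦_⟧ : ℤ → Carrier
  ⟦ + n ⟧      = n × 1#
  ⟦ -[1+ n ] ⟧ = - (suc n × 1#)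

  ⟦⟧-⊖ : ∀ m n → ⟦ m ℤ.⊖ n ⟧ ≈ m × 1# - n × 1#
  ⟦⟧-⊖ m       zero    = sym (trans (+-congˡ -0#≈0#) (+-identityʳ _))
  ⟦⟧-⊖ zero    (suc n) = sym (+-identityˡ _)
  ⟦⟧-⊖ (suc m) (suc n) = begin
    ⟦ suc m ℤ.⊖ suc n ⟧                       ≡⟨ ≡.cong ⟦_⟧ (ℤₚ.[1+m]⊖[1+n]≡m⊖n m n) ⟩
    ⟦ m ℤ.⊖ n ⟧                               ≈⟨ ⟦⟧-⊖ m n ⟩
    m × 1# - n × 1#                           ≈⟨ +-congʳ (sym (+-identityˡ _)) ⟩
    (0# + m × 1#) - n × 1#                    ≈⟨ +-congʳ (+-congʳ (sym (-‿inverseʳ 1#))) ⟩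
    ((1# - 1#) + m × 1#) - n × 1#             ≈⟨ +-congʳ (trans (+-assoc _ _ _) (trans (+-congˡ (+-comm _ _)) (sym (+-assoc _ _ _)))) ⟩
    ((1# + m × 1#) - 1#) - n × 1#             ≈⟨ trans (+-assoc _ _ _) (+-congˡ (⁻¹-∙-comm _ _)) ⟩
    (1# + m × 1#) - (1# + n × 1#)             ≈⟨ sym (+-cong (1+× m 1#) (-‿cong (1+× n 1#))) ⟩
    suc m × 1# - suc n × 1#                   ∎

  ⟦⟧-+ : ∀ x y → ⟦ x ℤ.+ y ⟧ ≈ ⟦ x ⟧ + ⟦ y ⟧
  ⟦⟧-+ (+ m)    (+ n)    = ×-homo-+ 1# m n
  ⟦⟧-+ (+ m)    -[1+ n ] = ⟦⟧-⊖ m (suc n)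
  ⟦⟧-+ -[1+ m ] (+ n)    = trans (⟦⟧-⊖ n (suc m)) (+-comm _ _)
  ⟦⟧-+ -[1+ m ] -[1+ n ] = begin
    - (suc (suc (m ℕ.+ n)) × 1#)          ≡⟨ ≡.cong (λ l → - (suc l × 1#)) (≡.sym (ℕₚ.+-suc m n)) ⟩
    - ((suc m ℕ.+ suc n) × 1#)            ≈⟨ -‿cong (×-homo-+ 1# (suc m) (suc n)) ⟩
    - (suc m × 1# + suc n × 1#)           ≈⟨ sym (⁻¹-∙-comm _ _) ⟩
    - (suc m × 1#) - suc n × 1#           ∎

  ⟦⟧-neg : ∀ x → ⟦ ℤ.- x ⟧ ≈ - ⟦ x ⟧
  ⟦⟧-neg (+ zero)  = sym -0#≈0#
  ⟦⟧-neg (+ suc n) = refl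
  ⟦⟧-neg -[1+ n ]  = sym (⁻¹-involutive _)

  ⟦⟧-pos* : ∀ m y → ⟦ + m ℤ.* y ⟧ ≈ m × 1# * ⟦ y ⟧
  ⟦⟧-pos* m (+ n)    = trans (reflexive (≡.cong ⟦_⟧ (≡.sym (ℤₚ.pos-* m n)))) (×1-homo-* m n)
  ⟦⟧-pos* m -[1+ n ] = begin
    ⟦ + m ℤ.* -[1+ n ] ⟧          ≡⟨ ≡.cong ⟦_⟧ (≡.sym (ℤₚ.neg-distribʳ-* (+ m) (+ suc n))) ⟩
    ⟦ ℤ.- (+ m ℤ.* + suc n) ⟧     ≈⟨ ⟦⟧-neg (+ m ℤ.* + suc n) ⟩
    - ⟦ + m ℤ.* + suc n ⟧         ≈⟨ -‿cong (⟦⟧-pos* m (+ suc n)) ⟩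
    - (m × 1# * (suc n × 1#))     ≈⟨ -‿distribʳ-* _ _ ⟩
    m × 1# * - (suc n × 1#)       ∎

  ⟦⟧-* : ∀ x y → ⟦ x ℤ.* y ⟧ ≈ ⟦ x ⟧ * ⟦ y ⟧
  ⟦⟧-* (+ m)    y = ⟦⟧-pos* m y
  ⟦⟧-* -[1+ m ] y = begin
    ⟦ -[1+ m ] ℤ.* y ⟧            ≡⟨ ≡.cong ⟦_⟧ (≡.sym (ℤₚ.neg-distribˡ-* (+ suc m) y)) ⟩
    ⟦ ℤ.- (+ suc m ℤ.* y) ⟧       ≈⟨ ⟦⟧-neg (+ suc m ℤ.* y) ⟩
    - ⟦ + suc m ℤ.* y ⟧           ≈⟨ -‿cong (⟦⟧-pos* (suc m) y) ⟩
    - (suc m × 1# * ⟦ y ⟧)        ≈⟨ -‿distribˡ-* _ _ ⟩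
    - (suc m × 1#) * ⟦ y ⟧        ∎

  morphism : CommutativeRing.rawRing ℤₚ.+-*-commutativeRing -Raw-AlmostCommutative⟶ fromCommutativeRing R
  morphism = record
    { ⟦_⟧    = ⟦_⟧
    ; +-homo = ⟦⟧-+
    ; *-homo = ⟦⟧-*
    ; -‿homo = ⟦⟧-neg
    ; 0-homo = refl
    ; 1-homo = refl
    }

  -- Equality in `R` need not be decidable. Comparing the integers themselves is sound, and enough
  -- to cancel opposite terms.
  ⟦⟧-≟ : ∀ x y → Maybe (⟦ x ⟧ ≈ ⟦ y ⟧)
  ⟦⟧-≟ x y = Maybe.map (λ { ≡.refl → refl }) (dec⇒maybe (x ℤ.≟ y))

  open Algebra.Solver.Ring (CommutativeRing.rawRing ℤₚ.+-*-commutativeRing) (fromCommutativeRing R) morphism ⟦⟧-≟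
    public using (solve; _:=_; _:+_; _:*_; _:-_; :-_; con)

-- Finite folds in a commutative monoid.

-- The new factor enters on the right, as in `finProd`, so that the two products unfold in step.
fold : ∀ {a} {A : Set a} → (A → A → A) → A → ℕ → (ℕ → A) → A
fold _∙_ ε zero    f = ε
fold _∙_ ε (suc n) f = fold _∙_ ε n f ∙ f n

module Range {c ℓ} (M : CommutativeMonoid c ℓ) where
  open CommutativeMonoid M
  open import Algebra.Properties.CommutativeSemigroup commutativeSemigroup using (interchange)

  ⨀ : ℕ → (ℕ → Carrier) → Carrier
  ⨀ = fold _∙_ ε

  fold-cong : ∀ n {f g} → (∀ m → m < n → f m ≈ g m) → ⨀ n f ≈ ⨀ n g
  fold-cong zero    eq = refl
  fold-cong (suc n) eq = ∙-cong (fold-cong n (λ m m<n → eq m (ℕₚ.m<n⇒m<1+n m<n))) (eq n ℕₚ.≤-refl)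

  fold-∙ : ∀ n f g → ⨀ n (λ m → f m ∙ g m) ≈ ⨀ n f ∙ ⨀ n g
  fold-∙ zero    f g = sym (identityˡ ε)
  fold-∙ (suc n) f g = trans (∙-congʳ (fold-∙ n f g)) (interchange _ _ _ _)

  fold-head : ∀ n f → ⨀ (suc n) f ≈ f 0 ∙ ⨀ n (λ m → f (suc m))
  fold-head zero    f = comm ε (f 0)
  fold-head (suc n) f = trans (∙-congʳ (fold-head n f)) (assoc _ _ _)

  fold-ε : ∀ n {f} → (∀ m → m < n → f m ≈ ε) → ⨀ n f ≈ ε
  fold-ε zero    eq = refl
  fold-ε (suc n) eq = trans (∙-cong (fold-ε n (λ m m<n → eq m (ℕₚ.m<n⇒m<1+n m<n))) (eq n ℕₚ.≤-refl)) (identityˡ ε)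

  fold-+ : ∀ m n f → ⨀ (m ℕ.+ n) f ≈ ⨀ m f ∙ ⨀ n (λ l → f (m ℕ.+ l))
  fold-+ m zero    f = trans (reflexive (≡.cong (λ l → ⨀ l f) (ℕₚ.+-identityʳ m))) (sym (identityʳ _))
  fold-+ m (suc n) f = trans (reflexive (≡.cong (λ l → ⨀ l f) (ℕₚ.+-suc m n))) (trans (∙-congʳ (fold-+ m n f)) (assoc _ _ _))

  fold-stable : ∀ {m n} → m ≤ n → ∀ {f} → (∀ l → m ≤ l → f l ≈ ε) → ⨀ n f ≈ ⨀ m f
  fold-stable {m} {n} m≤n {f} eq = trans
    (reflexive (≡.cong (λ l → ⨀ l f) (≡.sym (ℕₚ.m+[n∸m]≡n m≤n))))
    (trans (fold-+ m (n ℕ.∸ m) f)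
      (trans (∙-congˡ (fold-ε (n ℕ.∸ m) (λ l _ → eq (m ℕ.+ l) (ℕₚ.m≤m+n m l)))) (identityʳ _)))

  fold-blocks : ∀ l n f → ⨀ (l ℕ.* n) f ≈ ⨀ n (λ t → ⨀ l (λ s → f (l ℕ.* t ℕ.+ s)))
  fold-blocks l zero    f = reflexive (≡.cong (λ m → ⨀ m f) (ℕₚ.*-zeroʳ l))
  fold-blocks l (suc n) f = trans
    (reflexive (≡.cong (λ m → ⨀ m f) (≡.trans (ℕₚ.*-suc l n) (ℕₚ.+-comm l (l ℕ.* n)))))
    (trans (fold-+ (l ℕ.* n) l f) (∙-congʳ (fold-blocks l n f)))

  if-false : ∀ {b x} → ¬ T b → (if b then x else ε) ≈ ε
  if-false {false} _  = refl
  if-false {true}  ¬b = contradiction _ ¬b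

  if-true : ∀ {b x} → T b → (if b then x else ε) ≈ x
  if-true {true} _ = refl

  fold-select : ∀ n (p : ℕ → Bool) (f : ℕ → Carrier) {r} → r < n → T (p r) → (∀ s → s < n → T (p s) → s ≡ r) →
    ⨀ n (λ s → if p s then f s else ε) ≈ f r
  fold-select (suc n) p f {r} r<1+n pr unique with ℕₚ.m≤n⇒m<n∨m≡n (ℕ.s≤s⁻¹ r<1+n)
  ... | inj₁ r<n = trans
    (∙-cong (fold-select n p f r<n pr (λ s s<n → unique s (ℕₚ.m<n⇒m<1+n s<n)))
            (if-false (λ pn → ℕₚ.<-irrefl (≡.sym (unique n ℕₚ.≤-refl pn)) r<n)))
    (identityʳ (f r))
  ... | inj₂ ≡.refl = trans
    (∙-cong (fold-ε n (λ s s<n → if-false (λ ps → ℕₚ.<-irrefl (unique s (ℕₚ.m<n⇒m<1+n s<n) ps) s<n)))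
            (if-true pr))
    (identityˡ (f n))

-- The exponents α and β of the closed form.  Throughout, the paper's i is suc i here, and d = k - suc i,
-- so that k = suc (i + d) and no subtraction is needed.
α β : ℕ → ℕ → ℕ → ℕ → ℕ
α k j i μ = 2 ℕ.* (k ℕ.* (μ ℕ.* (μ ℕ.+ j))) ℕ.+ (suc (2 ℕ.* i)) ℕ.* μ
β k j d μ = 2 ℕ.* ((μ ℕ.+ suc j) ℕ.* (k ℕ.* μ ℕ.+ d)) ℕ.+ (μ ℕ.+ suc (2 ℕ.* j))

-- Over bare operations, so that the sums and products taken in different truncations are definitionally equal.
-- Here X m plays q^m and ι m plays (1 - q^m)⁻¹, hence ν m = (1 + q^m)⁻¹.
module Series {c} {A : Set c} (_+_ _*_ : A → A → A) (-_ : A → A) (0# 1# : A) (X ι : ℕ → A) where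
  infixl 6 _-_
  _-_ : A → A → A
  x - y = x + (- y)

  Σ Π : ℕ → (ℕ → A) → A
  Σ = fold _+_ 0#
  Π = fold _*_ 1#

  sgn : ℕ → A
  sgn zero    = 1#
  sgn (suc m) = - sgn m

  ν : ℕ → A
  ν m = (1# - X m) * ι (m ℕ.+ m)

  F : ℕ → A
  F L = Π L (λ m → (1# + X (suc (2 ℕ.* m))) * ι (2 ℕ.* suc m))

  module Terms (F₀ : A) where
    -- ρ j μ = F (q^{2μ+2})_j / (-q^{2μ+1})_{j+1}
    ρ : ℕ → ℕ → A
    ρ zero    μ = F₀ * ν (suc (2 ℕ.* μ))
    ρ (suc j) μ = ρ j μ * ((1# - X (2 ℕ.* (μ ℕ.+ suc j))) * ν (suc (2 ℕ.* (μ ℕ.+ suc j))))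

    a b : ℕ → ℕ → ℕ → ℕ → A
    a k j i μ = (sgn μ * (ρ j μ * (1# + X (suc (2 ℕ.* (μ ℕ.+ j)))))) * X (α k j i μ)
    b k j d μ = (sgn μ * (ρ j μ * (1# + X (suc (2 ℕ.* μ))))) * X (β k j d μ)

    C : ℕ → ℕ → ℕ → ℕ → ℕ → A
    C K k j i d = Σ K (λ μ → a k j i μ - b k j d μ)

-- Polynomial identities between the exponents.

module Exponents where
  open ℕ-Solver.+-*-Solver

  private
    sucᵖ : ∀ {n} → Polynomial n → Polynomial n
    sucᵖ x = con 1 :+ x

    αᵖ βᵖ : ∀ {n} → Polynomial n → Polynomial n → Polynomial n → Polynomial n → Polynomial n
    αᵖ k j i μ = con 2 :* (k :* (μ :* (μ :+ j))) :+ sucᵖ (con 2 :* i) :* μ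
    βᵖ k j d μ = con 2 :* ((μ :+ sucᵖ j) :* (k :* μ :+ d)) :+ (μ :+ sucᵖ (con 2 :* j))

  α-suc-d : ∀ i d j μ → α (suc (suc (i ℕ.+ d))) j (suc d) (suc μ) ≡ α (suc (suc (i ℕ.+ d))) j d (suc μ) ℕ.+ 2 ℕ.* suc μ
  α-suc-d = solve 4 (λ i d j μ → αᵖ (sucᵖ (sucᵖ (i :+ d))) j (sucᵖ d) (sucᵖ μ) := αᵖ (sucᵖ (sucᵖ (i :+ d))) j d (sucᵖ μ) :+ con 2 :* sucᵖ μ) ≡.refl

  α≡e₁+β : ∀ i d j μ → α (suc (suc (i ℕ.+ d))) j d (suc μ) ≡ 2 ℕ.* (suc j ℕ.* suc i) ℕ.+ β (suc (suc (i ℕ.+ d))) (suc j) d μ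
  α≡e₁+β = solve 4 (λ i d j μ → αᵖ (sucᵖ (sucᵖ (i :+ d))) j d (sucᵖ μ) := con 2 :* (sucᵖ j :* sucᵖ i) :+ βᵖ (sucᵖ (sucᵖ (i :+ d))) (sucᵖ j) d μ) ≡.refl

  α≡e₂+β : ∀ i d j μ → α (suc (suc (i ℕ.+ d))) j d (suc μ) ℕ.+ suc (2 ℕ.* (suc μ ℕ.+ j)) ≡ suc (2 ℕ.* (j ℕ.+ suc j ℕ.* i)) ℕ.+ β (suc (suc (i ℕ.+ d))) (suc j) (suc d) μ
  α≡e₂+β = solve 4 (λ i d j μ → αᵖ (sucᵖ (sucᵖ (i :+ d))) j d (sucᵖ μ) :+ sucᵖ (con 2 :* (sucᵖ μ :+ j)) := sucᵖ (con 2 :* (j :+ sucᵖ j :* i)) :+ βᵖ (sucᵖ (sucᵖ (i :+ d))) (sucᵖ j) (sucᵖ d) μ) ≡.refl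

  β-suc-i : ∀ i d j μ → β (suc (suc (i ℕ.+ d))) j (suc i) μ ≡ β (suc (suc (i ℕ.+ d))) j i μ ℕ.+ 2 ℕ.* (μ ℕ.+ suc j)
  β-suc-i = solve 4 (λ i d j μ → βᵖ (sucᵖ (sucᵖ (i :+ d))) j (sucᵖ i) μ := βᵖ (sucᵖ (sucᵖ (i :+ d))) j i μ :+ con 2 :* (μ :+ sucᵖ j)) ≡.refl

  β≡e₁+α : ∀ i d j μ → β (suc (suc (i ℕ.+ d))) j i μ ℕ.+ suc (2 ℕ.* μ) ≡ 2 ℕ.* (suc j ℕ.* suc i) ℕ.+ α (suc (suc (i ℕ.+ d))) (suc j) (suc i) μ
  β≡e₁+α = solve 4 (λ i d j μ → βᵖ (sucᵖ (sucᵖ (i :+ d))) j i μ :+ sucᵖ (con 2 :* μ) := con 2 :* (sucᵖ j :* sucᵖ i) :+ αᵖ (sucᵖ (sucᵖ (i :+ d))) (sucᵖ j) (sucᵖ i) μ) ≡.refl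

  β≡e₂+α : ∀ i d j μ → β (suc (suc (i ℕ.+ d))) j i μ ≡ suc (2 ℕ.* (j ℕ.+ suc j ℕ.* i)) ℕ.+ α (suc (suc (i ℕ.+ d))) (suc j) i μ
  β≡e₂+α = solve 4 (λ i d j μ → βᵖ (sucᵖ (sucᵖ (i :+ d))) j i μ := sucᵖ (con 2 :* (j :+ sucᵖ j :* i)) :+ αᵖ (sucᵖ (sucᵖ (i :+ d))) (sucᵖ j) i μ) ≡.refl

  α-0 : ∀ k j i → α k j i 0 ≡ 0
  α-0 = solve 3 (λ k j i → αᵖ k j i (con 0) := con 0) ≡.refl

  β-0 : ∀ k j → suc (2 ℕ.* j) ≡ β (suc k) j 0 0
  β-0 = solve 2 (λ k j → sucᵖ (con 2 :* j) := βᵖ (sucᵖ k) j (con 0) (con 0)) ≡.refl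

  α-edge₁ : ∀ k j μ → α (suc k) (suc j) 0 (suc μ) ≡ β (suc k) (suc j) k μ ℕ.+ 2 ℕ.* suc μ
  α-edge₁ = solve 3 (λ k j μ → αᵖ (sucᵖ k) (sucᵖ j) (con 0) (sucᵖ μ) := βᵖ (sucᵖ k) (sucᵖ j) k μ :+ con 2 :* sucᵖ μ) ≡.refl

  β≡α : ∀ k j μ → β (suc k) (suc j) k μ ≡ α (suc k) j k (suc μ)
  β≡α = solve 3 (λ k j μ → βᵖ (sucᵖ k) (sucᵖ j) k μ := αᵖ (sucᵖ k) j k (sucᵖ μ)) ≡.refl

  β-edge : ∀ k j μ → β (suc k) (suc j) k μ ℕ.+ suc (2 ℕ.* (suc μ ℕ.+ j)) ≡ β (suc k) j 0 (suc μ)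
  β-edge = solve 3 (λ k j μ → βᵖ (sucᵖ k) (sucᵖ j) k μ :+ sucᵖ (con 2 :* (sucᵖ μ :+ j)) := βᵖ (sucᵖ k) j (con 0) (sucᵖ μ)) ≡.refl

  α-suc : ∀ k j i μ → α (suc k) j i (suc μ) ≡ suc (2 ℕ.* j) ℕ.+ (2 ℕ.* suc μ ℕ.+ 2 ℕ.* ((k ℕ.+ μ ℕ.+ k ℕ.* μ) ℕ.* (suc μ ℕ.+ j)) ℕ.+ 2 ℕ.* (i ℕ.* suc μ) ℕ.+ μ)
  α-suc = solve 4 (λ k j i μ → αᵖ (sucᵖ k) j i (sucᵖ μ) := sucᵖ (con 2 :* j) :+ (con 2 :* sucᵖ μ :+ con 2 :* ((k :+ μ :+ k :* μ) :* (sucᵖ μ :+ j)) :+ con 2 :* (i :* sucᵖ μ) :+ μ)) ≡.refl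

  private
    Aᵖ Dᵖ : ∀ {n} → Polynomial n → Polynomial n → Polynomial n
    Aᵖ i d = con 2 :* sucᵖ (i :+ d) :+ sucᵖ (con 2 :* i)
    Dᵖ i d = Aᵖ i d :+ sucᵖ (con 2 :* d)

  e-step : ∀ i d n → let A = 2 ℕ.* suc (i ℕ.+ d) ℕ.+ suc (2 ℕ.* i); B = suc (2 ℕ.* d) in
    A ℕ.+ (A ℕ.+ B) ℕ.* n ℕ.+ α (suc (i ℕ.+ d)) 0 i n ≡ α (suc (i ℕ.+ d)) 0 i (suc n)
  e-step = solve 3 (λ i d n → Aᵖ i d :+ Dᵖ i d :* n :+ αᵖ (sucᵖ (i :+ d)) (con 0) i n := αᵖ (sucᵖ (i :+ d)) (con 0) i (sucᵖ n)) ≡.refl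

  β-00 : ∀ i d → suc (2 ℕ.* d) ℕ.+ 0 ℕ.+ 0 ≡ β (suc (i ℕ.+ d)) 0 d 0
  β-00 = solve 2 (λ i d → sucᵖ (con 2 :* d) :+ con 0 :+ con 0 := βᵖ (sucᵖ (i :+ d)) (con 0) d (con 0)) ≡.refl

  β-step : ∀ i d n → let A = 2 ℕ.* suc (i ℕ.+ d) ℕ.+ suc (2 ℕ.* i); B = suc (2 ℕ.* d) in
    B ℕ.+ (A ℕ.+ B) ℕ.* suc n ℕ.+ β (suc (i ℕ.+ d)) 0 d n ≡ β (suc (i ℕ.+ d)) 0 d (suc n)
  β-step = solve 3 (λ i d n → sucᵖ (con 2 :* d) :+ Dᵖ i d :* sucᵖ n :+ βᵖ (sucᵖ (i :+ d)) (con 0) d n := βᵖ (sucᵖ (i :+ d)) (con 0) d (sucᵖ n)) ≡.refl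

-- Residues modulo 4 and 4k.

-- Products start at m = 1, so a block of representatives is 1, ..., l. Only its last element is not
-- its own residue, hence the case split.
suc-%-injective : ∀ {l} .{{_ : ℕ.NonZero l}} {r s} → r < l → s < l → suc s % l ≡ suc r % l → s ≡ r
suc-%-injective {l} {r} {s} r<l s<l eq with ℕₚ.m≤n⇒m<n∨m≡n r<l | ℕₚ.m≤n⇒m<n∨m≡n s<l
... | inj₁ 1+r<l  | inj₁ 1+s<l  = ℕₚ.suc-injective (≡.trans (≡.sym (m<n⇒m%n≡m 1+s<l)) (≡.trans eq (m<n⇒m%n≡m 1+r<l)))
... | inj₁ 1+r<l  | inj₂ ≡.refl = contradiction (≡.trans (≡.sym (n%n≡0 l)) (≡.trans eq (m<n⇒m%n≡m 1+r<l))) λ ()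
... | inj₂ ≡.refl | inj₁ 1+s<l  = contradiction (≡.trans (≡.sym (n%n≡0 l)) (≡.trans (≡.sym eq) (m<n⇒m%n≡m 1+s<l))) λ ()
... | inj₂ 1+r≡l  | inj₂ 1+s≡l  = ℕₚ.suc-injective (≡.trans 1+s≡l (≡.sym 1+r≡l))

odd%4≢2 : ∀ m → ¬ (suc (2 ℕ.* m) % 4 ≡ 2)
odd%4≢2 m eq = contradiction (begin
  1 % 2                   ≡⟨ [m+kn]%n≡m%n 1 m 2 ⟨
  suc (m ℕ.* 2) % 2       ≡⟨ ≡.cong (λ x → suc x % 2) (ℕₚ.*-comm m 2) ⟩
  suc (2 ℕ.* m) % 2       ≡⟨ m∣n⇒o%n%m≡o%m 2 4 (suc (2 ℕ.* m)) (divides-refl 2) ⟨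
  suc (2 ℕ.* m) % 4 % 2   ≡⟨ ≡.cong (_% 2) eq ⟩
  0                       ∎) λ ()
  where open ≡.≡-Reasoning

%4k-%4 : ∀ k m .{{_ : ℕ.NonZero (4 ℕ.* k)}} → m % (4 ℕ.* k) % 4 ≡ m % 4
%4k-%4 k m = m∣n⇒o%n%m≡o%m 4 (4 ℕ.* k) m (m∣m*n k)

-- Algebra modulo q^N.

record NilpotentRing c ℓ (N : ℕ) : Set (Level.suc (c ⊔ ℓ)) where
  field
    commutativeRing : CommutativeRing c ℓ
  open CommutativeRing commutativeRing
  field
    X         : ℕ → Carrier
    X-0       : X 0 ≈ 1#
    X-+       : ∀ m n → X (m ℕ.+ n) ≈ X m * X n
    X-N       : X N ≈ 0#
    ι         : ℕ → Carrier
    ι-inverse : ∀ m → 1 ≤ m → (1# - X m) * ι m ≈ 1#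

module Truncated {c ℓ N} (S : NilpotentRing c ℓ N) where
  open NilpotentRing S
  open CommutativeRing commutativeRing
  open IntegerSolver commutativeRing
  open Exponents
  open import Algebra.Properties.Ring ring using (-0#≈0#)
  open import Relation.Binary.Reasoning.Setoid setoid
  open Series _+_ _*_ -_ 0# 1# X ι public hiding (_-_)
  open Range +-commutativeMonoid public using () renaming
    (fold-cong to Σ-cong; fold-∙ to Σ-+; fold-head to Σ-head; fold-stable to Σ-stable)
  open Range *-commutativeMonoid public using () renaming
    (fold-cong to Π-cong; fold-∙ to Π-*; fold-ε to Π-1; fold-stable to Π-stable; fold-blocks to Π-blocks; fold-select to Π-select)

  Σ-*ˡ : ∀ n x f → Σ n (λ m → x * f m) ≈ x * Σ n f
  Σ-*ˡ zero    x f = sym (zeroʳ x)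
  Σ-*ˡ (suc n) x f = trans (+-congʳ (Σ-*ˡ n x f)) (sym (distribˡ x _ _))

  Σ-neg : ∀ n f → Σ n (λ m → - f m) ≈ - Σ n f
  Σ-neg zero    f = sym -0#≈0#
  Σ-neg (suc n) f = trans (+-congʳ (Σ-neg n f)) (solve 2 (λ x y → :- x :- y := :- (x :+ y)) refl _ _)

  Σ-minus : ∀ n f g → Σ n (λ m → f m - g m) ≈ Σ n f - Σ n g
  Σ-minus n f g = trans (Σ-+ n f (λ m → - g m)) (+-congˡ (Σ-neg n g))

  -- The substitute for reindexing an infinite sum: the cut-off stays put because the term that
  -- would cross it vanishes.
  Σ-rotate : ∀ n {f} → f n ≈ 0# → Σ n f ≈ f 0 + Σ n (λ m → f (suc m))
  Σ-rotate n {f} eq = trans (trans (sym (+-identityʳ _)) (+-congˡ (sym eq))) (Σ-head n f)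

  X-split : ∀ {l} m n → l ≡ m ℕ.+ n → X l ≈ X m * X n
  X-split m n ≡.refl = X-+ m n

  X-vanish : ∀ {m} → N ≤ m → X m ≈ 0#
  X-vanish {m} N≤m = begin
    X m                    ≈⟨ X-split N (m ℕ.∸ N) (≡.sym (ℕₚ.m+[n∸m]≡n N≤m)) ⟩
    X N * X (m ℕ.∸ N)      ≈⟨ *-congʳ X-N ⟩
    0# * X (m ℕ.∸ N)       ≈⟨ zeroˡ _ ⟩
    0#                     ∎

  1-X≈1 : ∀ {m} → N ≤ m → 1# - X m ≈ 1#
  1-X≈1 N≤m = trans (+-congˡ (trans (-‿cong (X-vanish N≤m)) -0#≈0#)) (+-identityʳ 1#)

  1+X≈1 : ∀ {m} → N ≤ m → 1# + X m ≈ 1#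
  1+X≈1 N≤m = trans (+-congˡ (X-vanish N≤m)) (+-identityʳ 1#)

  ι≈1 : ∀ {m} → 1 ≤ m → N ≤ m → ι m ≈ 1#
  ι≈1 {m} 1≤m N≤m = trans (sym (trans (*-congʳ (1-X≈1 N≤m)) (*-identityˡ _))) (ι-inverse m 1≤m)

  -- Jacobi's triple product modulo q^N.

  module JacobiTriple (A B : ℕ) (1≤A : 1 ≤ A) (1≤B : 1 ≤ B) where
    D : ℕ
    D = A ℕ.+ B

    -- Write Q = q^D.  With a = A the exponent e a n is A n + D n(n-1)/2, that of the n-th theta term;
    -- with a = B it is that of the (-n)-th one.
    e : ℕ → ℕ → ℕ
    e a zero    = 0
    e a (suc n) = a ℕ.+ D ℕ.* n ℕ.+ e a n

    n≤e : ∀ {a} → 1 ≤ a → ∀ n → n ≤ e a n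
    n≤e 1≤a zero    = z≤n
    n≤e {a} 1≤a (suc n) = ℕₚ.+-mono-≤ (ℕₚ.≤-trans 1≤a (ℕₚ.m≤m+n a _)) (n≤e 1≤a n)

    X-e-vanish : ∀ {a} → 1 ≤ a → ∀ {n} → N ≤ n → X (e a n) ≈ 0#
    X-e-vanish 1≤a {n} N≤n = X-vanish (ℕₚ.≤-trans N≤n (n≤e 1≤a n))

    1≤D : 1 ≤ D
    1≤D = ℕₚ.≤-trans 1≤A (ℕₚ.m≤m+n A B)

    m≤D*m : ∀ m → m ≤ D ℕ.* m
    m≤D*m m = ℕₚ.m≤n*m m D {{ℕ.>-nonZero 1≤D}}

    -- These are (Q; Q)_n and its inverse.
    p r : ℕ → Carrier
    p n = Π n (λ m → 1# - X (D ℕ.* suc m))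
    r n = Π n (λ m → ι (D ℕ.* suc m))

    1≤D*suc : ∀ m → 1 ≤ D ℕ.* suc m
    1≤D*suc m = ℕₚ.≤-trans (s≤s z≤n) (m≤D*m (suc m))

    p*r≈1 : ∀ n → p n * r n ≈ 1#
    p*r≈1 n = trans (sym (Π-* n _ _)) (Π-1 n (λ m _ → ι-inverse (D ℕ.* suc m) (1≤D*suc m)))

    r-step : ∀ n → r n + X (D ℕ.* suc n) * r (suc n) ≈ r (suc n)
    r-step n = begin
      r n + x * (r n * y)                  ≈⟨ +-congʳ (sym (*-identityʳ _)) ⟩
      r n * 1# + x * (r n * y)             ≈⟨ +-congʳ (*-congˡ (sym (ι-inverse (D ℕ.* suc n) (1≤D*suc n)))) ⟩
      r n * ((1# - x) * y) + x * (r n * y) ≈⟨ solve 3 (λ r x y → r :* ((con (+ 1) :- x) :* y) :+ x :* (r :* y) := r :* y) refl _ _ _ ⟩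
      r n * y                              ∎
      where
      x y : Carrier
      x = X (D ℕ.* suc n)
      y = ι (D ℕ.* suc n)

    r-stable : ∀ {n} → N ≤ n → r n ≈ r N
    r-stable N≤n = Π-stable N≤n (λ l N≤l → ι≈1 (1≤D*suc l) (ℕₚ.≤-trans N≤l (ℕₚ.≤-trans (ℕₚ.n≤1+n l) (m≤D*m (suc l)))))

    module _ (K : ℕ) (N≤K : N ≤ K) where

      -- Euler's Σ_s (-1)^s y^s Q^{s(s-1)/2} / (Q; Q)_s = (y; Q)_∞ at y = q^B Q^L
      euler : ℕ → Carrier
      euler L = Σ K (λ s → sgn s * r s * X (e B s ℕ.+ D ℕ.* s ℕ.* L))

      -- In the difference of the two sums the term of index s + 1 carries 1 - Q^(s+1), which
      -- cancels the last factor of (Q; Q)_(s+1). What remains is -q^B Q^L times the term of index s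
      -- of `euler (suc L)`.
      euler-step : ∀ L → euler L ≈ (1# - X (B ℕ.+ D ℕ.* L)) * euler (suc L)
      euler-step L = begin
        euler L
          ≈⟨ solve 2 (λ x y → x := y :+ (x :- y)) refl _ _ ⟩
        euler (suc L) + (euler L - euler (suc L))
          ≈⟨ +-congˡ (sym (Σ-minus K _ _)) ⟩
        euler (suc L) + Σ K f
          ≈⟨ +-congˡ (trans (Σ-rotate K f-K) (trans (+-congʳ f-0) (+-identityˡ _))) ⟩
        euler (suc L) + Σ K (λ s → f (suc s))
          ≈⟨ +-congˡ (trans (Σ-cong K (λ s _ → f-suc s)) (Σ-*ˡ K _ _)) ⟩
        euler (suc L) + - X (B ℕ.+ D ℕ.* L) * euler (suc L)
          ≈⟨ solve 2 (λ x y → y :+ :- x :* y := (con (+ 1) :- x) :* y) refl _ _ ⟩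
        (1# - X (B ℕ.+ D ℕ.* L)) * euler (suc L)
          ∎
        where
        f : ℕ → Carrier
        f s = sgn s * r s * X (e B s ℕ.+ D ℕ.* s ℕ.* L) - sgn s * r s * X (e B s ℕ.+ D ℕ.* s ℕ.* suc L)
        f-K : f K ≈ 0#
        f-K = trans (+-cong (*-congˡ (vanish _)) (-‿cong (*-congˡ (vanish _))))
          (solve 1 (λ x → x :* con (+ 0) :- x :* con (+ 0) := con (+ 0)) refl _)
          where
          vanish : ∀ l → X (e B K ℕ.+ l) ≈ 0#
          vanish l = X-vanish (ℕₚ.≤-trans (ℕₚ.≤-trans N≤K (n≤e 1≤B K)) (ℕₚ.m≤m+n _ l))
        f-0 : f 0 ≈ 0#
        f-0 = trans (+-congʳ (*-congˡ (reflexive (≡.cong X (lem D L))))) (-‿inverseʳ _)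
          where
          lem : ∀ D L → D ℕ.* 0 ℕ.* L ≡ D ℕ.* 0 ℕ.* suc L
          lem = solve-∀
        f-suc : ∀ s → f (suc s) ≈ - X (B ℕ.+ D ℕ.* L) * (sgn s * r s * X (e B s ℕ.+ D ℕ.* s ℕ.* suc L))
        f-suc s = begin
          - sgn s * r (suc s) * X (e B (suc s) ℕ.+ D ℕ.* suc s ℕ.* L) - - sgn s * r (suc s) * X (e B (suc s) ℕ.+ D ℕ.* suc s ℕ.* suc L)
            ≈⟨ +-cong (*-congˡ split₁) (-‿cong (*-congˡ split₂)) ⟩
          - sgn s * r (suc s) * (b * x) - - sgn s * r (suc s) * (b * x * y)
            ≈⟨ solve 5 (λ σ r b x y → :- σ :* r :* (b :* x) :- :- σ :* r :* (b :* x :* y) := :- b :* (σ :* (r :- y :* r) :* x)) refl _ _ _ _ _ ⟩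
          - b * (sgn s * (r (suc s) - y * r (suc s)) * x)
            ≈⟨ *-congˡ (*-congʳ (*-congˡ (+-congʳ (sym (r-step s))))) ⟩
          - b * (sgn s * (r s + y * r (suc s) - y * r (suc s)) * x)
            ≈⟨ *-congˡ (*-congʳ (*-congˡ (solve 2 (λ x y → x :+ y :- y := x) refl _ _))) ⟩
          - b * (sgn s * r s * x)
            ∎
          where
          b x y : Carrier
          b = X (B ℕ.+ D ℕ.* L)
          x = X (e B s ℕ.+ D ℕ.* s ℕ.* suc L)
          y = X (D ℕ.* suc s)
          lem₁ : ∀ B D L s eB → B ℕ.+ D ℕ.* s ℕ.+ eB ℕ.+ D ℕ.* suc s ℕ.* L ≡ B ℕ.+ D ℕ.* L ℕ.+ (eB ℕ.+ D ℕ.* s ℕ.* suc L)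
          lem₁ = solve-∀
          lem₂ : ∀ B D L s eB → B ℕ.+ D ℕ.* s ℕ.+ eB ℕ.+ D ℕ.* suc s ℕ.* suc L ≡ B ℕ.+ D ℕ.* L ℕ.+ (eB ℕ.+ D ℕ.* s ℕ.* suc L) ℕ.+ D ℕ.* suc s
          lem₂ = solve-∀
          split₁ : X (e B (suc s) ℕ.+ D ℕ.* suc s ℕ.* L) ≈ b * x
          split₁ = X-split _ _ (lem₁ B D L s (e B s))
          split₂ : X (e B (suc s) ℕ.+ D ℕ.* suc s ℕ.* suc L) ≈ b * x * y
          split₂ = trans (X-split _ _ (lem₂ B D L s (e B s))) (*-congʳ (X-+ _ _))

      euler-N : 1 ≤ K → euler N ≈ 1#
      euler-N 1≤K = trans (Σ-stable 1≤K vanish) (trans (+-identityˡ _)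
          (trans (*-cong (*-identityˡ 1#) (trans (reflexive (≡.cong (λ l → X (l ℕ.* N)) (ℕₚ.*-zeroʳ D))) X-0)) (*-identityˡ 1#)))
        where
        vanish : ∀ s → 1 ≤ s → sgn s * r s * X (e B s ℕ.+ D ℕ.* s ℕ.* N) ≈ 0#
        vanish s 1≤s = trans (*-congˡ (X-vanish (ℕₚ.≤-trans (ℕₚ.m≤n*m N (D ℕ.* s) {{ℕ.>-nonZero (ℕₚ.≤-trans 1≤s (m≤D*m s))}}) (ℕₚ.m≤n+m _ (e B s))))) (zeroʳ _)

      euler-product : ∀ L → euler 0 ≈ Π L (λ n → 1# - X (B ℕ.+ D ℕ.* n)) * euler L
      euler-product zero    = sym (*-identityˡ _)
      euler-product (suc L) = trans (euler-product L) (trans (*-congˡ (euler-step L)) (sym (*-assoc _ _ _)))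

      -- ω M l = 1 / (Q; Q)_{M-l} and κ M l = Q^{M-l} ω M l, both 0 for l > M
      ω κ : ℕ → ℕ → Carrier
      ω M       zero    = r M
      ω zero    (suc l) = 0#
      ω (suc M) (suc l) = ω M l
      κ M       zero    = X (D ℕ.* M) * r M
      κ zero    (suc l) = 0#
      κ (suc M) (suc l) = κ M l

      ω-step : ∀ M l → ω M l + κ (suc M) l ≈ ω (suc M) l
      ω-step M       zero          = r-step M
      -- The boundary l = M + 1: `ω M l` is already 0, and 1/(Q; Q)_0 comes from `κ` alone.
      ω-step zero    (suc zero)    = trans (+-identityˡ _) (trans (*-congʳ (trans (reflexive (≡.cong X (ℕₚ.*-zeroʳ D))) X-0)) (*-identityˡ _))
      ω-step zero    (suc (suc l)) = +-identityˡ _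
      ω-step (suc M) (suc l)       = ω-step M l

      X-ω : ∀ M l → X (D ℕ.* M) * ω M l ≈ X (D ℕ.* l) * κ M l
      X-ω M       zero    = sym (trans (*-congʳ (trans (reflexive (≡.cong X (ℕₚ.*-zeroʳ D))) X-0)) (*-identityˡ _))
      X-ω zero    (suc l) = trans (zeroʳ _) (sym (zeroʳ _))
      X-ω (suc M) (suc l) = begin
        X (D ℕ.* suc M) * ω M l             ≈⟨ *-congʳ (X-split D (D ℕ.* M) (ℕₚ.*-suc D M)) ⟩
        X D * X (D ℕ.* M) * ω M l           ≈⟨ trans (*-assoc _ _ _) (*-congˡ (X-ω M l)) ⟩
        X D * (X (D ℕ.* l) * κ M l)         ≈⟨ sym (*-assoc _ _ _) ⟩
        X D * X (D ℕ.* l) * κ M l           ≈⟨ *-congʳ (sym (X-split D (D ℕ.* l) (ℕₚ.*-suc D l))) ⟩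
        X (D ℕ.* suc l) * κ M l             ∎

      ω-diagonal : ∀ l x → ω (l ℕ.+ x) l ≈ r x
      ω-diagonal zero    x = refl
      ω-diagonal (suc l) x = ω-diagonal l x

      -- V M = Σ_{l ∈ ℤ} (-1)^l t_l / (Q; Q)_{M-l} over the theta terms t_l.  Since q^A Q^l t_l = t_{l+1} and
      -- 1/(Q)_m + Q^{m+1}/(Q)_{m+1} = 1/(Q)_{m+1}, multiplication by 1 - q^A Q^M takes V M to V (M + 1).
      S₁ S₂ V : ℕ → Carrier
      S₁ M = Σ K (λ l → sgn l * X (e A l) * ω M l)
      S₂ M = Σ K (λ s → sgn s * X (e B (suc s)) * r (suc (M ℕ.+ s)))
      V M = S₁ M - S₂ M

      -- At M = 0 the weights vanish for l > 0. The surviving terms, with l = -s, are those of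
      -- Euler's sum.
      V-zero : 1 ≤ K → V 0 ≈ euler 0
      V-zero 1≤K = begin
        S₁ 0 - S₂ 0
          ≈⟨ +-cong S₁-0 (sym (Σ-neg K _)) ⟩
        sgn 0 * r 0 * X (e B 0 ℕ.+ D ℕ.* 0 ℕ.* 0) + Σ K (λ s → - (sgn s * X (e B (suc s)) * r (suc s)))
          ≈⟨ +-congˡ (Σ-cong K (λ s _ → trans (solve 3 (λ σ x r → :- (σ :* x :* r) := :- σ :* r :* x) refl _ _ _)
               (*-congˡ (reflexive (≡.cong X (≡.trans (≡.sym (ℕₚ.+-identityʳ _)) (≡.cong (e B (suc s) ℕ.+_) (≡.sym (ℕₚ.*-zeroʳ (D ℕ.* suc s)))))))))) ⟩
        sgn 0 * r 0 * X (e B 0 ℕ.+ D ℕ.* 0 ℕ.* 0) + Σ K (λ s → sgn (suc s) * r (suc s) * X (e B (suc s) ℕ.+ D ℕ.* suc s ℕ.* 0))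
          ≈⟨ sym (Σ-rotate K (trans (*-congˡ (X-vanish (ℕₚ.≤-trans (ℕₚ.≤-trans N≤K (n≤e 1≤B K)) (ℕₚ.m≤m+n _ _)))) (zeroʳ _))) ⟩
        euler 0 ∎
        where
        S₁-0 : S₁ 0 ≈ sgn 0 * r 0 * X (e B 0 ℕ.+ D ℕ.* 0 ℕ.* 0)
        S₁-0 = begin
          S₁ 0                    ≈⟨ Σ-stable 1≤K (λ { (suc l) _ → zeroʳ _ }) ⟩
          0# + 1# * X 0 * 1#      ≈⟨ +-identityˡ _ ⟩
          1# * X 0 * 1#           ≈⟨ trans (*-assoc _ _ _) (trans (*-congˡ (*-comm _ _)) (sym (*-assoc _ _ _))) ⟩
          1# * 1# * X 0           ≈⟨ *-congˡ (reflexive (≡.cong X (≡.sym (ℕₚ.*-zeroʳ (D ℕ.* 0))))) ⟩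
          1# * 1# * X (D ℕ.* 0 ℕ.* 0) ∎

      V-step : ∀ M → V (suc M) ≈ (1# - X (A ℕ.+ D ℕ.* M)) * V M
      V-step M = begin
        S₁ (suc M) - S₂ (suc M)
          ≈⟨ +-cong S₁-suc (-‿cong S₂-suc) ⟩
        S₁ M + W - (S₂ M + Z)
          ≈⟨ solve 5 (λ s₁ s₂ w z k → s₁ :+ w :- (s₂ :+ z) := s₁ :- s₂ :- ((k :- w) :- (k :- z))) refl _ _ _ _ _ ⟩
        S₁ M - S₂ M - ((κ₀ - W) - (κ₀ - Z))
          ≈⟨ +-congˡ (-‿cong (+-cong (sym y-S₁) (-‿cong (sym y-S₂)))) ⟩
        S₁ M - S₂ M - (y * S₁ M - y * S₂ M)
          ≈⟨ solve 3 (λ s₁ s₂ y → s₁ :- s₂ :- (y :* s₁ :- y :* s₂) := (con (+ 1) :- y) :* (s₁ :- s₂)) refl _ _ _ ⟩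
        (1# - y) * V M ∎
        where
        y κ₀ W Z : Carrier
        y = X (A ℕ.+ D ℕ.* M)
        -- The term at l = 0. The shift l to l + 1 moves it from the negative half of the bilateral
        -- sum into the other half, so it enters both halves of `y * V M` and cancels in their
        -- difference.
        κ₀ = X (D ℕ.* suc M) * r (suc M)
        W = Σ K (λ l → sgn l * X (e A l) * κ (suc M) l)
        g : ℕ → Carrier
        g s = sgn s * (X (D ℕ.* suc (M ℕ.+ s)) * X (e B s) * r (suc (M ℕ.+ s)))
        Z = Σ K (λ s → - g (suc s))
        S₁-suc : S₁ (suc M) ≈ S₁ M + W
        S₁-suc = trans (Σ-cong K (λ l _ → trans (*-congˡ (sym (ω-step M l))) (distribˡ _ _ _))) (Σ-+ K _ _)
        S₂-suc : S₂ (suc M) ≈ S₂ M + Z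
        S₂-suc = trans (Σ-cong K (λ s _ → term s)) (Σ-+ K _ _)
          where
          term : ∀ s → sgn s * X (e B (suc s)) * r (suc (suc M ℕ.+ s)) ≈ sgn s * X (e B (suc s)) * r (suc (M ℕ.+ s)) + - g (suc s)
          term s = begin
            sgn s * X (e B (suc s)) * r (suc (suc M ℕ.+ s))
              ≈⟨ *-congˡ (sym (r-step (suc (M ℕ.+ s)))) ⟩
            sgn s * X (e B (suc s)) * (r (suc (M ℕ.+ s)) + X (D ℕ.* suc (suc (M ℕ.+ s))) * r (suc (suc (M ℕ.+ s))))
              ≈⟨ solve 5 (λ σ x r y t → σ :* x :* (r :+ y :* t) := σ :* x :* r :+ :- (:- σ :* (y :* x :* t))) refl _ _ _ _ _ ⟩
            sgn s * X (e B (suc s)) * r (suc (M ℕ.+ s)) + - (- sgn s * (X (D ℕ.* suc (suc (M ℕ.+ s))) * X (e B (suc s)) * r (suc (suc (M ℕ.+ s)))))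
              ≡⟨ ≡.cong (λ l → sgn s * X (e B (suc s)) * r (suc (M ℕ.+ s)) + - (- sgn s * (X (D ℕ.* suc l) * X (e B (suc s)) * r (suc l)))) (≡.sym (ℕₚ.+-suc M s)) ⟩
            sgn s * X (e B (suc s)) * r (suc (M ℕ.+ s)) + - g (suc s) ∎
        y-S₁ : y * S₁ M ≈ κ₀ - W
        y-S₁ = begin
          y * S₁ M
            ≈⟨ sym (Σ-*ˡ K _ _) ⟩
          Σ K (λ l → y * (sgn l * X (e A l) * ω M l))
            ≈⟨ Σ-cong K (λ l _ → term l) ⟩
          Σ K (λ l → - h (suc l))
            ≈⟨ Σ-neg K _ ⟩
          - Σ K (λ l → h (suc l))
            ≈⟨ solve 2 (λ x y → :- y := x :- (x :+ y)) refl _ _ ⟩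
          κ₀ - (κ₀ + Σ K (λ l → h (suc l)))
            ≈⟨ +-congˡ (-‿cong (+-congʳ (sym (trans (*-congʳ (trans (*-identityˡ _) X-0)) (*-identityˡ _))))) ⟩
          κ₀ - (h 0 + Σ K (λ l → h (suc l)))
            ≈⟨ +-congˡ (-‿cong (sym (Σ-rotate K (trans (*-congʳ (trans (*-congˡ (X-e-vanish 1≤A N≤K)) (zeroʳ _))) (zeroˡ _))))) ⟩
          κ₀ - W ∎
          where
          h : ℕ → Carrier
          h l = sgn l * X (e A l) * κ (suc M) l
          term : ∀ l → y * (sgn l * X (e A l) * ω M l) ≈ - h (suc l)
          term l = begin
            y * (sgn l * X (e A l) * ω M l)
              ≈⟨ *-congʳ (X-+ A _) ⟩
            X A * X (D ℕ.* M) * (sgn l * X (e A l) * ω M l)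
              ≈⟨ solve 5 (λ a m σ x w → a :* m :* (σ :* x :* w) := a :* (σ :* x :* (m :* w))) refl _ _ _ _ _ ⟩
            X A * (sgn l * X (e A l) * (X (D ℕ.* M) * ω M l))
              ≈⟨ *-congˡ (*-congˡ (X-ω M l)) ⟩
            X A * (sgn l * X (e A l) * (X (D ℕ.* l) * κ M l))
              ≈⟨ solve 5 (λ a m σ x w → a :* (σ :* x :* (m :* w)) := :- (:- σ :* (a :* m :* x) :* w)) refl _ _ _ _ _ ⟩
            - (- sgn l * (X A * X (D ℕ.* l) * X (e A l)) * κ M l)
              ≈⟨ -‿cong (*-congʳ (*-congˡ (sym (trans (X-+ _ _) (*-congʳ (X-+ _ _)))))) ⟩
            - h (suc l) ∎
        y-S₂ : y * S₂ M ≈ κ₀ - Z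
        y-S₂ = begin
          y * S₂ M
            ≈⟨ sym (Σ-*ˡ K _ _) ⟩
          Σ K (λ s → y * (sgn s * X (e B (suc s)) * r (suc (M ℕ.+ s))))
            ≈⟨ Σ-cong K (λ s _ → term s) ⟩
          Σ K g
            ≈⟨ Σ-rotate K (trans (*-congˡ (trans (*-congʳ (trans (*-congˡ (X-e-vanish 1≤B N≤K)) (zeroʳ _))) (zeroˡ _))) (zeroʳ _)) ⟩
          g 0 + Σ K (λ s → g (suc s))
            ≈⟨ +-cong g-0 (solve 1 (λ x → x := :- (:- x)) refl _) ⟩
          κ₀ - (- Σ K (λ s → g (suc s)))
            ≈⟨ +-congˡ (-‿cong (sym (Σ-neg K _))) ⟩
          κ₀ - Z ∎
          where
          g-0 : g 0 ≈ κ₀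
          g-0 = begin
            1# * (X (D ℕ.* suc (M ℕ.+ 0)) * X 0 * r (suc (M ℕ.+ 0)))
              ≡⟨ ≡.cong (λ l → 1# * (X (D ℕ.* suc l) * X 0 * r (suc l))) (ℕₚ.+-identityʳ M) ⟩
            1# * (X (D ℕ.* suc M) * X 0 * r (suc M))
              ≈⟨ trans (*-identityˡ _) (*-congʳ (trans (*-congˡ X-0) (*-identityʳ _))) ⟩
            κ₀ ∎
          lem : ∀ A B M s eB → A ℕ.+ (A ℕ.+ B) ℕ.* M ℕ.+ (B ℕ.+ (A ℕ.+ B) ℕ.* s ℕ.+ eB) ≡ (A ℕ.+ B) ℕ.* suc (M ℕ.+ s) ℕ.+ eB
          lem = solve-∀
          term : ∀ s → y * (sgn s * X (e B (suc s)) * r (suc (M ℕ.+ s))) ≈ g s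
          term s = begin
            y * (sgn s * X (e B (suc s)) * r (suc (M ℕ.+ s)))
              ≈⟨ solve 4 (λ y σ x r → y :* (σ :* x :* r) := σ :* (y :* x :* r)) refl _ _ _ _ ⟩
            sgn s * (y * X (e B (suc s)) * r (suc (M ℕ.+ s)))
              ≈⟨ *-congˡ (*-congʳ (trans (sym (X-+ _ _)) (X-split _ _ (lem A B M s (e B s))))) ⟩
            g s ∎

      V-product : ∀ M → V M ≈ Π M (λ n → 1# - X (A ℕ.+ D ℕ.* n)) * V 0
      V-product zero    = sym (*-identityˡ _)
      V-product (suc M) = trans (V-step M) (trans (*-congˡ (V-product M)) (solve 3 (λ x y z → x :* (y :* z) := y :* x :* z) refl _ _ _))

      theta : Carrier
      theta = Σ K (λ l → sgn l * (X (e A l) - X (e B (suc l))))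

      -- M = N + N already counts as infinity: for l ≤ N the weight has index M - l ≥ N, where `r`
      -- is constant modulo q^N, and for l ≥ N the theta term itself vanishes.
      V-limit : V (N ℕ.+ N) ≈ r N * theta
      V-limit = begin
        V (N ℕ.+ N)
          ≈⟨ sym (Σ-minus K _ _) ⟩
        Σ K (λ l → sgn l * X (e A l) * ω (N ℕ.+ N) l - sgn l * X (e B (suc l)) * r (suc (N ℕ.+ N ℕ.+ l)))
          ≈⟨ Σ-cong K (λ l _ → +-cong (term l) (-‿cong (*-congˡ (r-stable (ℕₚ.≤-trans (ℕₚ.m≤m+n N N) (ℕₚ.≤-trans (ℕₚ.m≤m+n _ l) (ℕₚ.n≤1+n _))))))) ⟩
        Σ K (λ l → sgn l * X (e A l) * r N - sgn l * X (e B (suc l)) * r N)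
          ≈⟨ Σ-cong K (λ l _ → solve 4 (λ σ x y r → σ :* x :* r :- σ :* y :* r := r :* (σ :* (x :- y))) refl _ _ _ _) ⟩
        Σ K (λ l → r N * (sgn l * (X (e A l) - X (e B (suc l)))))
          ≈⟨ Σ-*ˡ K _ _ ⟩
        r N * theta ∎
        where
        term : ∀ l → sgn l * X (e A l) * ω (N ℕ.+ N) l ≈ sgn l * X (e A l) * r N
        term l with ℕₚ.≤-total l N
        ... | inj₁ l≤N = *-congˡ (begin
          ω (N ℕ.+ N) l                   ≡⟨ ≡.cong (λ m → ω m l) (≡.trans (≡.cong (ℕ._+ N) (≡.sym (ℕₚ.m+[n∸m]≡n l≤N))) (ℕₚ.+-assoc l _ N)) ⟩
          ω (l ℕ.+ (N ℕ.∸ l ℕ.+ N)) l     ≈⟨ ω-diagonal l _ ⟩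
          r (N ℕ.∸ l ℕ.+ N)               ≈⟨ r-stable (ℕₚ.m≤n+m N (N ℕ.∸ l)) ⟩
          r N                             ∎)
        ... | inj₂ N≤l = trans (zero-term _) (sym (zero-term _))
          where
          zero-term : ∀ z → sgn l * X (e A l) * z ≈ 0#
          zero-term z = trans (*-congʳ (trans (*-congˡ (X-e-vanish 1≤A N≤l)) (zeroʳ _))) (zeroˡ _)

      -- `V` interpolates between Euler's sum, which is (q^B; Q)_∞, and theta / (Q; Q)_∞. Each step
      -- of M contributes one factor of (q^A; Q)_∞. The unequal lengths of the last two products
      -- come from `V-limit`.
      triple-product : 1 ≤ K → theta ≈
        p N * (Π (N ℕ.+ N) (λ n → 1# - X (A ℕ.+ D ℕ.* n)) * Π N (λ n → 1# - X (B ℕ.+ D ℕ.* n)))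
      triple-product 1≤K = begin
        theta                              ≈⟨ sym (*-identityˡ _) ⟩
        1# * theta                         ≈⟨ *-congʳ (sym (p*r≈1 N)) ⟩
        p N * r N * theta                  ≈⟨ trans (*-assoc _ _ _) (*-congˡ (sym V-limit)) ⟩
        p N * V (N ℕ.+ N)                  ≈⟨ *-congˡ (trans (V-product (N ℕ.+ N)) (*-congˡ (V-zero 1≤K))) ⟩
        p N * (Π (N ℕ.+ N) (λ n → 1# - X (A ℕ.+ D ℕ.* n)) * euler 0)
          ≈⟨ *-congˡ (*-congˡ (trans (euler-product N) (trans (*-congˡ (euler-N 1≤K)) (*-identityʳ _)))) ⟩
        p N * (Π (N ℕ.+ N) (λ n → 1# - X (A ℕ.+ D ℕ.* n)) * Π N (λ n → 1# - X (B ℕ.+ D ℕ.* n))) ∎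

  -- The closed form satisfies the recursion.

  ν-inverse : ∀ m → 1 ≤ m → (1# + X m) * ν m ≈ 1#
  ν-inverse m 1≤m = begin
    (1# + X m) * ((1# - X m) * ι (m ℕ.+ m))
      ≈⟨ solve 2 (λ x y → (con (+ 1) :+ x) :* ((con (+ 1) :- x) :* y) := (con (+ 1) :- x :* x) :* y) refl _ _ ⟩
    (1# - X m * X m) * ι (m ℕ.+ m)
      ≈⟨ *-congʳ (+-congˡ (-‿cong (sym (X-+ m m)))) ⟩
    (1# - X (m ℕ.+ m)) * ι (m ℕ.+ m)
      ≈⟨ ι-inverse (m ℕ.+ m) (ℕₚ.≤-trans 1≤m (ℕₚ.m≤m+n m m)) ⟩
    1# ∎

  module ClosedForm (F₀ : Carrier) where
    open Terms F₀ public

    ρ-zero : ∀ μ → ρ 0 μ * (1# + X (suc (2 ℕ.* μ))) ≈ F₀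
    ρ-zero μ = begin
      F₀ * y * (1# + x)     ≈⟨ solve 3 (λ f y x → f :* y :* (con (+ 1) :+ x) := f :* ((con (+ 1) :+ x) :* y)) refl _ _ _ ⟩
      F₀ * ((1# + x) * y)   ≈⟨ *-congˡ (ν-inverse (suc (2 ℕ.* μ)) (s≤s z≤n)) ⟩
      F₀ * 1#               ≈⟨ *-identityʳ F₀ ⟩
      F₀                    ∎
      where
      x y : Carrier
      x = X (suc (2 ℕ.* μ))
      y = ν (suc (2 ℕ.* μ))

    ρ-step : ∀ j μ → ρ (suc j) μ * (1# + X (suc (2 ℕ.* (μ ℕ.+ suc j)))) ≈ ρ j μ * (1# - X (2 ℕ.* (μ ℕ.+ suc j)))
    ρ-step j μ = begin
      ρ j μ * (z * y) * (1# + x)     ≈⟨ solve 4 (λ f z y x → f :* (z :* y) :* (con (+ 1) :+ x) := f :* z :* ((con (+ 1) :+ x) :* y)) refl _ _ _ _ ⟩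
      ρ j μ * z * ((1# + x) * y)     ≈⟨ *-congˡ (ν-inverse (suc (2 ℕ.* (μ ℕ.+ suc j))) (s≤s z≤n)) ⟩
      ρ j μ * z * 1#                 ≈⟨ *-identityʳ _ ⟩
      ρ j μ * z                      ∎
      where
      x y z : Carrier
      x = X (suc (2 ℕ.* (μ ℕ.+ suc j)))
      y = ν (suc (2 ℕ.* (μ ℕ.+ suc j)))
      z = 1# - X (2 ℕ.* (μ ℕ.+ suc j))

    -- `ρ-step` strips the last factor of numerator and denominator; this strips the first ones, so
    -- the remaining symbols start at μ + 1. The former drives `b-difference`, the latter
    -- `a-difference`.
    ρ-shift : ∀ j μ → ρ (suc j) μ * (1# + X (suc (2 ℕ.* μ))) ≈ ρ j (suc μ) * (1# - X (2 ℕ.* suc μ))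
    ρ-shift zero μ = begin
      ρ 0 μ * E (μ ℕ.+ 1) * x       ≡⟨ ≡.cong (λ m → ρ 0 μ * E m * x) (ℕₚ.+-comm μ 1) ⟩
      ρ 0 μ * (z * y) * x           ≈⟨ solve 4 (λ a b c d → a :* (b :* c) :* d := (a :* d) :* c :* b) refl _ _ _ _ ⟩
      (ρ 0 μ * x) * y * z           ≈⟨ *-congʳ (*-congʳ (ρ-zero μ)) ⟩
      F₀ * y * z                     ∎
      where
      E : ℕ → Carrier
      E m = (1# - X (2 ℕ.* m)) * ν (suc (2 ℕ.* m))
      x y z : Carrier
      x = 1# + X (suc (2 ℕ.* μ))
      y = ν (suc (2 ℕ.* suc μ))
      z = 1# - X (2 ℕ.* suc μ)
    ρ-shift (suc j) μ = begin
      ρ (suc j) μ * E (μ ℕ.+ suc (suc j)) * x    ≡⟨ ≡.cong (λ m → ρ (suc j) μ * E m * x) (ℕₚ.+-suc μ (suc j)) ⟩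
      ρ (suc j) μ * E (suc μ ℕ.+ suc j) * x      ≈⟨ solve 3 (λ a b c → a :* b :* c := a :* c :* b) refl _ _ _ ⟩
      ρ (suc j) μ * x * E (suc μ ℕ.+ suc j)      ≈⟨ *-congʳ (ρ-shift j μ) ⟩
      ρ j (suc μ) * z * E (suc μ ℕ.+ suc j)      ≈⟨ solve 3 (λ a b c → a :* b :* c := a :* c :* b) refl _ _ _ ⟩
      ρ j (suc μ) * E (suc μ ℕ.+ suc j) * z      ∎
      where
      E : ℕ → Carrier
      E m = (1# - X (2 ℕ.* m)) * ν (suc (2 ℕ.* m))
      x z : Carrier
      x = 1# + X (suc (2 ℕ.* μ))
      z = 1# - X (2 ℕ.* suc μ)

    a-vanish : ∀ k j i {μ} → N ≤ μ → a k j i μ ≈ 0#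
    a-vanish k j i {μ} N≤μ = trans (*-congˡ (X-vanish (ℕₚ.≤-trans N≤μ (ℕₚ.≤-trans (ℕₚ.m≤n*m μ (suc (2 ℕ.* i))) (ℕₚ.m≤n+m _ (2 ℕ.* (k ℕ.* (μ ℕ.* (μ ℕ.+ j))))))))) (zeroʳ _)

    b-vanish : ∀ k j d {μ} → N ≤ μ → b k j d μ ≈ 0#
    b-vanish k j d {μ} N≤μ = trans (*-congˡ (X-vanish (ℕₚ.≤-trans N≤μ (ℕₚ.≤-trans (ℕₚ.m≤m+n μ _) (ℕₚ.m≤n+m _ (2 ℕ.* ((μ ℕ.+ suc j) ℕ.* (k ℕ.* μ ℕ.+ d)))))))) (zeroʳ _)

    -- Under the recursion, a at level j with index μ + 1 becomes b at level j + 1 with index μ, and b at level j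
    -- becomes a at level j + 1 with the same index; e₁ = 2(j+1)(i-1) and e₂ = e₁ - 1 for the paper's i ≥ 2.
    module _ (i d j : ℕ) where
      private
        k J e₁ e₂ : ℕ
        k = suc (suc (i ℕ.+ d))
        J = suc j
        e₁ = 2 ℕ.* (J ℕ.* suc i)
        e₂ = suc (2 ℕ.* (j ℕ.+ J ℕ.* i))

      -- The two exponents differ by 2(μ + 1), so a factor 1 - q^(2μ+2) comes out and `ρ-shift`
      -- trades it for a higher level. The factor 1 + u then expands into the two monomials with e₁
      -- and e₂.
      a-difference : ∀ μ → a k j d (suc μ) - a k j (suc d) (suc μ) ≈ - (X e₁ * b k J d μ + X e₂ * b k J (suc d) μ)
      a-difference μ = begin
        - σ * (ρ j (suc μ) * (1# + u)) * M - - σ * (ρ j (suc μ) * (1# + u)) * X (α k j (suc d) (suc μ))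
          ≈⟨ +-congˡ (-‿cong (*-congˡ (X-split _ _ (α-suc-d i d j μ)))) ⟩
        - σ * (ρ j (suc μ) * (1# + u)) * M - - σ * (ρ j (suc μ) * (1# + u)) * (M * w)
          ≈⟨ solve 5 (λ σ ρ u m w → :- σ :* (ρ :* (con (+ 1) :+ u)) :* m :- :- σ :* (ρ :* (con (+ 1) :+ u)) :* (m :* w)
               := :- (σ :* (ρ :* (con (+ 1) :- w)) :* (m :+ m :* u))) refl _ _ _ _ _ ⟩
        - (σ * (ρ j (suc μ) * (1# - w)) * (M + M * u))
          ≈⟨ -‿cong (*-congʳ (*-congˡ (sym (ρ-shift j μ)))) ⟩
        - (y * (M + M * u))
          ≈⟨ -‿cong (*-congˡ (+-cong (X-split _ _ (α≡e₁+β i d j μ)) (trans (sym (X-+ _ _)) (X-split _ _ (α≡e₂+β i d j μ))))) ⟩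
        - (y * (X e₁ * X (β k J d μ) + X e₂ * X (β k J (suc d) μ)))
          ≈⟨ solve 5 (λ y a b c d → :- (y :* (a :* b :+ c :* d)) := :- (a :* (y :* b) :+ c :* (y :* d))) refl _ _ _ _ _ ⟩
        - (X e₁ * b k J d μ + X e₂ * b k J (suc d) μ) ∎
        where
        σ u w y M : Carrier
        σ = sgn μ
        u = X (suc (2 ℕ.* (suc μ ℕ.+ j)))
        w = X (2 ℕ.* suc μ)
        y = σ * (ρ J μ * (1# + X (suc (2 ℕ.* μ))))
        M = X (α k j d (suc μ))

      b-difference : ∀ μ → b k j (suc i) μ - b k j i μ ≈ - (X e₁ * a k J (suc i) μ + X e₂ * a k J i μ)
      b-difference μ = begin
        σ * (ρ j μ * (1# + v)) * X (β k j (suc i) μ) - σ * (ρ j μ * (1# + v)) * M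
          ≈⟨ +-congʳ (*-congˡ (X-split _ _ (β-suc-i i d j μ))) ⟩
        σ * (ρ j μ * (1# + v)) * (M * w) - σ * (ρ j μ * (1# + v)) * M
          ≈⟨ solve 5 (λ σ ρ v m w → σ :* (ρ :* (con (+ 1) :+ v)) :* (m :* w) :- σ :* (ρ :* (con (+ 1) :+ v)) :* m
               := :- (σ :* (ρ :* (con (+ 1) :- w)) :* (m :* v :+ m))) refl _ _ _ _ _ ⟩
        - (σ * (ρ j μ * (1# - w)) * (M * v + M))
          ≈⟨ -‿cong (*-congʳ (*-congˡ (sym (ρ-step j μ)))) ⟩
        - (y * (M * v + M))
          ≈⟨ -‿cong (*-congˡ (+-cong (trans (sym (X-+ _ _)) (X-split _ _ (β≡e₁+α i d j μ))) (X-split _ _ (β≡e₂+α i d j μ)))) ⟩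
        - (y * (X e₁ * X (α k J (suc i) μ) + X e₂ * X (α k J i μ)))
          ≈⟨ solve 5 (λ y a b c d → :- (y :* (a :* b :+ c :* d)) := :- (a :* (y :* b) :+ c :* (y :* d))) refl _ _ _ _ _ ⟩
        - (X e₁ * a k J (suc i) μ + X e₂ * a k J i μ) ∎
        where
        σ v w y M : Carrier
        σ = sgn μ
        v = X (suc (2 ℕ.* μ))
        w = X (2 ℕ.* (μ ℕ.+ J))
        y = σ * (ρ J μ * (1# + X (suc (2 ℕ.* (μ ℕ.+ J)))))
        M = X (β k j i μ)

    -- At the seam G_{(k-1)(j+1)+1} = G_{(k-1)j+k} the terms agree only after regrouping: a with index μ + 1 has
    -- to be paired with b with index μ on the left-hand side.
    module _ (k′ j : ℕ) where
      private
        k J : ℕ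
        k = suc k′
        J = suc j

      edge-zero : a k J 0 0 ≈ a k j k′ 0 - b k j 0 0
      edge-zero = begin
        1# * (ρ J 0 * (1# + X (suc (2 ℕ.* J)))) * X (α k J 0 0)
          ≈⟨ *-cong (*-congˡ (ρ-step j 0)) (trans (reflexive (≡.cong X (α-0 k J 0))) X-0) ⟩
        1# * (ρ j 0 * (1# - X (2 ℕ.* J))) * 1#
          -- Factoring q^(2j+2) as u v allows 1 - u v = (1 + u) - u (1 + v), the two brackets of
          -- level j.
          ≈⟨ *-congʳ (*-congˡ (*-congˡ (+-congˡ (-‿cong (X-split _ _ (lem₃ j)))))) ⟩
        1# * (ρ j 0 * (1# - u * v)) * 1#
          ≈⟨ solve 3 (λ r u v → con (+ 1) :* (r :* (con (+ 1) :- u :* v)) :* con (+ 1)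
               := con (+ 1) :* (r :* (con (+ 1) :+ u)) :* con (+ 1) :- con (+ 1) :* (r :* (con (+ 1) :+ v)) :* u) refl _ _ _ ⟩
        1# * (ρ j 0 * (1# + u)) * 1# - 1# * (ρ j 0 * (1# + v)) * u
          ≈⟨ +-cong (*-congˡ (sym (trans (reflexive (≡.cong X (α-0 k j k′))) X-0))) (-‿cong (*-congˡ (reflexive (≡.cong X (β-0 k′ j))))) ⟩
        a k j k′ 0 - b k j 0 0 ∎
        where
        u v : Carrier
        u = X (suc (2 ℕ.* j))
        v = X 1
        lem₃ : ∀ j → 2 ℕ.* suc j ≡ suc (2 ℕ.* j) ℕ.+ 1
        lem₃ = solve-∀

      -- The brackets on the left merge as w (1 - g) + (1 - w) = 1 - g w. Since g w = h v, this
      -- splits again as (1 + h) - h (1 + v).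
      edge-suc : ∀ μ → a k J 0 (suc μ) - b k J k′ μ ≈ a k j k′ (suc μ) - b k j 0 (suc μ)
      edge-suc μ = begin
        - σ * (ρ J m * (1# + X (suc (2 ℕ.* (m ℕ.+ J))))) * X (α k J 0 m) - σ * (ρ J μ * (1# + X (suc (2 ℕ.* μ)))) * Z
          ≈⟨ +-cong (*-cong (*-congˡ (ρ-step j m)) (X-split _ _ (α-edge₁ k′ j μ))) (-‿cong (*-congʳ (*-congˡ (ρ-shift j μ)))) ⟩
        - σ * (ρ j m * (1# - g)) * (Z * w) - σ * (ρ j m * (1# - w)) * Z
          ≈⟨ solve 5 (λ σ r g z w → :- σ :* (r :* (con (+ 1) :- g)) :* (z :* w) :- σ :* (r :* (con (+ 1) :- w)) :* z
               := :- σ :* r :* z :* (con (+ 1) :- g :* w)) refl _ _ _ _ _ ⟩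
        - σ * ρ j m * Z * (1# - g * w)
          ≈⟨ *-congˡ (+-congˡ (-‿cong (trans (sym (X-+ _ _)) (X-split _ _ (lem₂ j μ))))) ⟩
        - σ * ρ j m * Z * (1# - h * v)
          ≈⟨ solve 5 (λ σ r h z v → :- σ :* r :* z :* (con (+ 1) :- h :* v)
               := :- σ :* (r :* (con (+ 1) :+ h)) :* z :- :- σ :* (r :* (con (+ 1) :+ v)) :* (z :* h)) refl _ _ _ _ _ ⟩
        - σ * (ρ j m * (1# + h)) * Z - - σ * (ρ j m * (1# + v)) * (Z * h)
          ≈⟨ +-cong (*-congˡ (reflexive (≡.cong X (β≡α k′ j μ)))) (-‿cong (*-congˡ (trans (sym (X-+ _ _)) (reflexive (≡.cong X (β-edge k′ j μ)))))) ⟩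
        a k j k′ m - b k j 0 m ∎
        where
        m : ℕ
        m = suc μ
        σ w g h v Z : Carrier
        σ = sgn μ
        w = X (2 ℕ.* m)
        g = X (2 ℕ.* (m ℕ.+ J))
        h = X (suc (2 ℕ.* (m ℕ.+ j)))
        v = X (suc (2 ℕ.* m))
        Z = X (β k J k′ μ)
        lem₂ : ∀ j μ → 2 ℕ.* (suc μ ℕ.+ suc j) ℕ.+ 2 ℕ.* suc μ ≡ suc (2 ℕ.* (suc μ ℕ.+ j)) ℕ.+ suc (2 ℕ.* suc μ)
        lem₂ = solve-∀

    module _ (K : ℕ) (N≤K : N ≤ K) where

      -- The defining recursion multiplied by q^(e₁), which removes all negative exponents. The
      -- reflection of the index in the recursion appears as the exchange of i and d.
      C-recursion : ∀ i d j → let k = suc (suc (i ℕ.+ d)) in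
        C K k j d (suc i) - C K k j (suc d) i ≈
        X (2 ℕ.* (suc j ℕ.* suc i)) * C K k (suc j) (suc i) d + X (suc (2 ℕ.* (j ℕ.+ suc j ℕ.* i))) * C K k (suc j) i (suc d)
      C-recursion i d j = begin
        C K k j d (suc i) - C K k j (suc d) i
          ≈⟨ sym (Σ-minus K _ _) ⟩
        Σ K (λ μ → a k j d μ - b k j (suc i) μ - (a k j (suc d) μ - b k j i μ))
          ≈⟨ Σ-cong K (λ μ _ → solve 4 (λ a b c d → a :- b :- (c :- d) := (a :- c) :- (b :- d)) refl _ _ _ _) ⟩
        Σ K (λ μ → A μ - (b k j (suc i) μ - b k j i μ))
          ≈⟨ Σ-minus K _ _ ⟩
        Σ K A - Σ K (λ μ → b k j (suc i) μ - b k j i μ)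
          -- Only the a-part shifts its index. Its term at μ = 0 drops out because `α` is 0 there
          -- whatever the index i.
          ≈⟨ +-cong (Σ-rotate K A-K) (-‿cong (Σ-cong K (λ μ _ → b-difference i d j μ))) ⟩
        A 0 + Σ K (λ μ → A (suc μ)) - Σ K (λ μ → - a′ μ)
          ≈⟨ +-cong (+-cong A-0 (Σ-cong K (λ μ _ → a-difference i d j μ))) (-‿cong (Σ-neg K a′)) ⟩
        0# + Σ K (λ μ → - b′ μ) - - Σ K a′
          ≈⟨ +-congʳ (+-congˡ (Σ-neg K b′)) ⟩
        0# + - Σ K b′ - - Σ K a′
          ≈⟨ solve 2 (λ x y → con (+ 0) :+ :- x :- :- y := y :- x) refl _ _ ⟩
        Σ K a′ - Σ K b′
          ≈⟨ sym (Σ-minus K _ _) ⟩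
        Σ K (λ μ → a′ μ - b′ μ)
          ≈⟨ Σ-cong K (λ μ _ → solve 6 (λ x y a b c d → (x :* a :+ y :* b) :- (x :* c :+ y :* d) := x :* (a :- c) :+ y :* (b :- d)) refl _ _ _ _ _ _) ⟩
        Σ K (λ μ → x * (a k J (suc i) μ - b k J d μ) + y * (a k J i μ - b k J (suc d) μ))
          ≈⟨ trans (Σ-+ K _ _) (+-cong (Σ-*ˡ K _ _) (Σ-*ˡ K _ _)) ⟩
        x * C K k J (suc i) d + y * C K k J i (suc d) ∎
        where
        k J : ℕ
        k = suc (suc (i ℕ.+ d))
        J = suc j
        x y : Carrier
        x = X (2 ℕ.* (J ℕ.* suc i))
        y = X (suc (2 ℕ.* (j ℕ.+ J ℕ.* i)))
        A a′ b′ : ℕ → Carrier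
        A μ = a k j d μ - a k j (suc d) μ
        a′ μ = x * a k J (suc i) μ + y * a k J i μ
        b′ μ = x * b k J d μ + y * b k J (suc d) μ
        A-K : A K ≈ 0#
        A-K = trans (+-cong (a-vanish k j d N≤K) (-‿cong (a-vanish k j (suc d) N≤K))) (-‿inverseʳ 0#)
        A-0 : A 0 ≈ 0#
        A-0 = trans (+-congʳ (*-congˡ (reflexive (≡.cong X (≡.trans (α-0 k j d) (≡.sym (α-0 k j (suc d)))))))) (-‿inverseʳ _)

      C-edge : ∀ k j → C K (suc k) (suc j) 0 k ≈ C K (suc k) j k 0
      C-edge k′ j = begin
        Σ K (λ μ → x μ - y μ)
          ≈⟨ Σ-minus K x y ⟩
        Σ K x - Σ K y
          ≈⟨ +-congʳ (Σ-rotate K (a-vanish k J 0 N≤K)) ⟩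
        x 0 + Σ K (λ μ → x (suc μ)) - Σ K y
          ≈⟨ trans (+-assoc _ _ _) (+-congˡ (sym (Σ-minus K _ y))) ⟩
        x 0 + Σ K (λ μ → x (suc μ) - y μ)
          ≈⟨ +-cong (edge-zero k′ j) (Σ-cong K (λ μ _ → edge-suc k′ j μ)) ⟩
        z 0 - w 0 + Σ K (λ μ → z (suc μ) - w (suc μ))
          ≈⟨ sym (Σ-rotate K (trans (+-cong (a-vanish k j k′ N≤K) (-‿cong (b-vanish k j 0 N≤K))) (-‿inverseʳ 0#))) ⟩
        Σ K (λ μ → z μ - w μ) ∎
        where
        k J : ℕ
        k = suc k′
        J = suc j
        x y z w : ℕ → Carrier
        x = a k J 0
        y = b k J k′
        z = a k j k′
        w = b k j 0

  -- The closed form modulo q^(2j+1).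

  module _ (L : ℕ) where
    open ClosedForm (F L)

    private
      F⁻¹ : ℕ → Carrier
      F⁻¹ j = Π j (λ m → (1# - X (2 ℕ.* suc m)) * ν (suc (2 ℕ.* m)))

      F*F⁻¹ : ∀ j → F j * F⁻¹ j ≈ 1#
      F*F⁻¹ j = trans (sym (Π-* j _ _)) (Π-1 j λ m _ → begin
        (1# + X (suc (2 ℕ.* m))) * ι (2 ℕ.* suc m) * ((1# - X (2 ℕ.* suc m)) * ν (suc (2 ℕ.* m)))
          ≈⟨ solve 4 (λ a b c d → a :* b :* (c :* d) := (a :* d) :* (c :* b)) refl _ _ _ _ ⟩
        ((1# + X (suc (2 ℕ.* m))) * ν (suc (2 ℕ.* m))) * ((1# - X (2 ℕ.* suc m)) * ι (2 ℕ.* suc m))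
          ≈⟨ *-cong (ν-inverse (suc (2 ℕ.* m)) (s≤s z≤n)) (ι-inverse (2 ℕ.* suc m) (s≤s z≤n)) ⟩
        1# * 1#   ≈⟨ *-identityˡ 1# ⟩
        1#        ∎)

      ρ-F⁻¹ : ∀ j → ρ j 0 * (1# + X (suc (2 ℕ.* j))) ≈ F L * F⁻¹ j
      ρ-F⁻¹ zero    = trans (ρ-zero 0) (sym (*-identityʳ _))
      ρ-F⁻¹ (suc j) = begin
        ρ (suc j) 0 * (1# + X (suc (2 ℕ.* suc j)))
          ≈⟨ ρ-step j 0 ⟩
        ρ j 0 * z
          ≈⟨ *-congʳ (sym (*-identityʳ _)) ⟩
        ρ j 0 * 1# * z
          ≈⟨ *-congʳ (*-congˡ (sym (ν-inverse (suc (2 ℕ.* j)) (s≤s z≤n)))) ⟩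
        ρ j 0 * (x * y) * z
          ≈⟨ solve 4 (λ r x y z → r :* (x :* y) :* z := (r :* x) :* (z :* y)) refl _ _ _ _ ⟩
        (ρ j 0 * x) * (z * y)
          ≈⟨ trans (*-congʳ (ρ-F⁻¹ j)) (*-assoc _ _ _) ⟩
        F L * F⁻¹ (suc j) ∎
        where
        x y z : Carrier
        x = 1# + X (suc (2 ℕ.* j))
        y = ν (suc (2 ℕ.* j))
        z = 1# - X (2 ℕ.* suc j)

    -- The cut-offs K and L are independent of N, because `closed` fixes them by the working
    -- precision while the result is read modulo the smaller q^(2j+1).
    C≈1 : ∀ K (N≤K : N ≤ K) → 1 ≤ K → ∀ k j i d → j ≤ L → N ≤ suc (2 ℕ.* j) → C K (suc k) j i d ≈ 1#
    C≈1 K N≤K 1≤K k j i d j≤L N≤2j+1 = begin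
      C K (suc k) j i d
        ≈⟨ Σ-cong K (λ μ _ → trans (+-congˡ (trans (-‿cong (b≈0 μ)) -0#≈0#)) (+-identityʳ _)) ⟩
      Σ K (a (suc k) j i)
        ≈⟨ Σ-stable 1≤K (λ { (suc μ) _ → a≈0 μ }) ⟩
      0# + 1# * (ρ j 0 * (1# + X (suc (2 ℕ.* j)))) * X (α (suc k) j i 0)
        ≈⟨ +-identityˡ _ ⟩
      1# * (ρ j 0 * (1# + X (suc (2 ℕ.* j)))) * X (α (suc k) j i 0)
        ≈⟨ *-cong (*-identityˡ _) (trans (reflexive (≡.cong X (α-0 (suc k) j i))) X-0) ⟩
      ρ j 0 * (1# + X (suc (2 ℕ.* j))) * 1#
        ≈⟨ trans (*-identityʳ _) (ρ-F⁻¹ j) ⟩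
      F L * F⁻¹ j
        ≈⟨ *-congʳ (Π-stable j≤L (λ l j≤l → trans (*-cong (1+X≈1 (small l j≤l)) (ι≈1 (s≤s z≤n) (ℕₚ.≤-trans (small l j≤l) (lem₃ l)))) (*-identityˡ 1#))) ⟩
      F j * F⁻¹ j
        ≈⟨ F*F⁻¹ j ⟩
      1# ∎
      where
      lem₃ : ∀ l → suc (2 ℕ.* l) ≤ 2 ℕ.* suc l
      lem₃ l = ℕₚ.≤-trans (ℕₚ.n≤1+n _) (ℕₚ.≤-reflexive (≡.sym (ℕₚ.*-suc 2 l)))
      small : ∀ l → j ≤ l → N ≤ suc (2 ℕ.* l)
      small l j≤l = ℕₚ.≤-trans N≤2j+1 (s≤s (ℕₚ.*-monoʳ-≤ 2 j≤l))
      a≈0 : ∀ μ → a (suc k) j i (suc μ) ≈ 0#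
      a≈0 μ = trans (*-congˡ (X-vanish (ℕₚ.≤-trans N≤2j+1 (ℕₚ.≤-trans (ℕₚ.m≤m+n _ _) (ℕₚ.≤-reflexive (≡.sym (α-suc k j i μ))))))) (zeroʳ _)
      b≈0 : ∀ μ → b (suc k) j d μ ≈ 0#
      b≈0 μ = trans (*-congˡ (X-vanish (ℕₚ.≤-trans N≤2j+1 (ℕₚ.≤-trans (ℕₚ.m≤n+m _ μ) (ℕₚ.m≤n+m _ (2 ℕ.* ((μ ℕ.+ suc j) ℕ.* (suc k ℕ.* μ ℕ.+ d)))))))) (zeroʳ _)

  -- The base products as theta series.

  -- Each block of l consecutive indices meets the class exactly once. The residue `c` is separate
  -- from `suc r` because the representative l has residue 0.
  Π-residue : ∀ l .{{_ : ℕ.NonZero l}} {r} c → r < l → suc r % l ≡ c → ∀ n (f : ℕ → Carrier) →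
    Π (l ℕ.* n) (λ m → if suc m % l ≡ᵇ c then f (suc m) else 1#) ≈ Π n (λ t → f (suc (l ℕ.* t ℕ.+ r)))
  Π-residue l {r} c r<l ≡.refl n f = trans (Π-blocks l n _) (Π-cong n λ t _ →
    Π-select l (λ s → suc (l ℕ.* t ℕ.+ s) % l ≡ᵇ suc r % l) (λ s → f (suc (l ℕ.* t ℕ.+ s))) r<l
      (ℕₚ.≡⇒≡ᵇ (suc (l ℕ.* t ℕ.+ r) % l) (suc r % l) (drop t r))
      (λ s s<l eq → suc-%-injective r<l s<l (≡.trans (≡.sym (drop t s)) (ℕₚ.≡ᵇ⇒≡ (suc (l ℕ.* t ℕ.+ s) % l) (suc r % l) eq))))
    where
    drop : ∀ t s → suc (l ℕ.* t ℕ.+ s) % l ≡ suc s % l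
    drop t s = ≡.trans (≡.cong (_% l) (≡.trans (≡.sym (ℕₚ.+-suc (l ℕ.* t) s)) (≡.trans (ℕₚ.+-comm (l ℕ.* t) (suc s)) (≡.cong (suc s ℕ.+_) (ℕₚ.*-comm l t)))))
      ([m+kn]%n≡m%n (suc s) t l)

  -- With x = 1 - q^m and y its inverse, an allowed m cancels and an excluded m leaves x. Pairwise
  -- disjointness of the four excluded classes ensures that x is counted once on the right.
  cancel-allowed : ∀ b₂ b₀ b₊ b₋ {x y} →
    (T b₂ → ¬ T b₀) → (T b₂ → ¬ T b₊) → (T b₂ → ¬ T b₋) → (T b₀ → ¬ T b₊) → (T b₀ → ¬ T b₋) → (T b₊ → ¬ T b₋) →
    x * y ≈ 1# →
    (if not b₂ ∧ not b₀ ∧ not b₊ ∧ not b₋ then y else 1#) * x ≈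
    (if b₂ then x else 1#) * ((if b₀ then x else 1#) * ((if b₊ then x else 1#) * (if b₋ then x else 1#)))
  cancel-allowed true  true  _     _     ₂₀ ₂₊ ₂₋ ₀₊ ₀₋ ₊₋ xy = contradiction _ (₂₀ _)
  cancel-allowed true  false true  _     ₂₀ ₂₊ ₂₋ ₀₊ ₀₋ ₊₋ xy = contradiction _ (₂₊ _)
  cancel-allowed true  false false true  ₂₀ ₂₊ ₂₋ ₀₊ ₀₋ ₊₋ xy = contradiction _ (₂₋ _)
  cancel-allowed false true  true  _     ₂₀ ₂₊ ₂₋ ₀₊ ₀₋ ₊₋ xy = contradiction _ (₀₊ _)
  cancel-allowed false true  false true  ₂₀ ₂₊ ₂₋ ₀₊ ₀₋ ₊₋ xy = contradiction _ (₀₋ _)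
  cancel-allowed false false true  true  ₂₀ ₂₊ ₂₋ ₀₊ ₀₋ ₊₋ xy = contradiction _ (₊₋ _)
  cancel-allowed true  false false false _ _ _ _ _ _ _ =
    solve 1 (λ x → con (+ 1) :* x := x :* (con (+ 1) :* (con (+ 1) :* con (+ 1)))) refl _
  cancel-allowed false true  false false _ _ _ _ _ _ _ =
    solve 1 (λ x → con (+ 1) :* x := con (+ 1) :* (x :* (con (+ 1) :* con (+ 1)))) refl _
  cancel-allowed false false true  false _ _ _ _ _ _ _ =
    solve 1 (λ x → con (+ 1) :* x := con (+ 1) :* (con (+ 1) :* (x :* con (+ 1)))) refl _
  cancel-allowed false false false true  _ _ _ _ _ _ _ =
    solve 1 (λ x → con (+ 1) :* x := con (+ 1) :* (con (+ 1) :* (con (+ 1) :* x))) refl _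
  cancel-allowed false false false false _ _ _ _ _ _ xy =
    trans (*-comm _ _) (trans xy (solve 0 (con (+ 1) := con (+ 1) :* (con (+ 1) :* (con (+ 1) :* con (+ 1)))) refl))

  module Base (i d : ℕ) where
    private
      k A B : ℕ
      k = suc (i ℕ.+ d)
      -- The excluded residues 2k + (2i-1) and 2k - (2i-1), at index `suc i`. They add up to 4k, so
      -- with 0 they are the three progressions of the triple product.
      A = 2 ℕ.* k ℕ.+ suc (2 ℕ.* i)
      B = suc (2 ℕ.* d)
    open JacobiTriple A B (ℕₚ.≤-trans (s≤s z≤n) (ℕₚ.m≤n+m (suc (2 ℕ.* i)) (2 ℕ.* k))) (s≤s z≤n)

    private
      D≡4k : D ≡ 4 ℕ.* k
      D≡4k = lem i d
        where
        lem : ∀ i d → 2 ℕ.* suc (i ℕ.+ d) ℕ.+ suc (2 ℕ.* i) ℕ.+ suc (2 ℕ.* d) ≡ 4 ℕ.* suc (i ℕ.+ d)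
        lem = solve-∀

      A<4k : A < 4 ℕ.* k
      A<4k = ≡.subst (A <_) D≡4k (ℕₚ.m<m+n A (s≤s z≤n))

      B<4k : B < 4 ℕ.* k
      B<4k = ≡.subst (B <_) D≡4k (ℕₚ.m<n+m B (ℕₚ.≤-trans (s≤s z≤n) (ℕₚ.m≤n+m (suc (2 ℕ.* i)) (2 ℕ.* k))))

      residue₊ : (2 ℕ.* k ℕ.+ (2 ℕ.* suc i ℕ.∸ 1)) % (4 ℕ.* k) ≡ A
      residue₊ = ≡.trans (≡.cong (λ x → (2 ℕ.* k ℕ.+ x) % (4 ℕ.* k)) (ℕₚ.+-suc i (i ℕ.+ 0))) (m<n⇒m%n≡m A<4k)

      residue₋ : (2 ℕ.* k ℕ.∸ (2 ℕ.* suc i ℕ.∸ 1)) % (4 ℕ.* k) ≡ B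
      residue₋ = ≡.trans (≡.cong (_% (4 ℕ.* k)) (≡.trans (≡.cong₂ ℕ._∸_ (lem i d) (ℕₚ.+-suc i (i ℕ.+ 0))) (ℕₚ.m+n∸n≡m B (suc (2 ℕ.* i))))) (m<n⇒m%n≡m B<4k)
        where
        lem : ∀ i d → 2 ℕ.* suc (i ℕ.+ d) ≡ suc (2 ℕ.* d) ℕ.+ suc (2 ℕ.* i)
        lem = solve-∀

      e-A : ∀ n → e A n ≡ α k 0 i n
      e-A zero    = ≡.sym (α-0 k 0 i)
      e-A (suc n) = ≡.trans (≡.cong (A ℕ.+ D ℕ.* n ℕ.+_) (e-A n)) (e-step i d n)

      e-B : ∀ n → e B (suc n) ≡ β k 0 d n
      e-B zero    = ≡.trans (≡.cong (λ x → B ℕ.+ x ℕ.+ 0) (ℕₚ.*-zeroʳ D)) (β-00 i d)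
      e-B (suc n) = ≡.trans (≡.cong (B ℕ.+ D ℕ.* suc n ℕ.+_) (e-B n)) (β-step i d n)

    factor : ℕ → Carrier
    factor m = if allowed k (suc i) (suc m) then ι (suc m) else 1#

    private
      x h₂ h₀ h₊ h₋ : ℕ → Carrier
      x m = 1# - X m
      h₂ m = if suc m % 4 ≡ᵇ 2 then x (suc m) else 1#
      h₀ m = if suc m % (4 ℕ.* k) ≡ᵇ 0 then x (suc m) else 1#
      h₊ m = if suc m % (4 ℕ.* k) ≡ᵇ (2 ℕ.* k ℕ.+ (2 ℕ.* suc i ℕ.∸ 1)) % (4 ℕ.* k) then x (suc m) else 1#
      h₋ m = if suc m % (4 ℕ.* k) ≡ᵇ (2 ℕ.* k ℕ.∸ (2 ℕ.* suc i ℕ.∸ 1)) % (4 ℕ.* k) then x (suc m) else 1#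

      factor-cancel : ∀ m → factor m * x (suc m) ≈ h₂ m * (h₀ m * (h₊ m * h₋ m))
      factor-cancel m = cancel-allowed (suc m % 4 ≡ᵇ 2) (rem ≡ᵇ 0) (rem ≡ᵇ c₊) (rem ≡ᵇ c₋)
        (λ t u → absurd-0 (to₂ t) (to₀ u))
        (λ t u → absurd-odd (k ℕ.+ i) (lem k i) (to₂ t) (to₊ u))
        (λ t u → absurd-odd d ≡.refl (to₂ t) (to₋ u))
        (λ t u → contradiction (≡.trans (≡.sym (to₊ u)) (to₀ t)) λ ())
        (λ t u → contradiction (≡.trans (≡.sym (to₋ u)) (to₀ t)) λ ())
        (λ t u → A≢B (≡.trans (≡.sym (to₊ t)) (to₋ u)))
        (ι-inverse (suc m) (s≤s z≤n))
        where
        rem c₊ c₋ : ℕ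
        rem = suc m % (4 ℕ.* k)
        c₊ = (2 ℕ.* k ℕ.+ (2 ℕ.* suc i ℕ.∸ 1)) % (4 ℕ.* k)
        c₋ = (2 ℕ.* k ℕ.∸ (2 ℕ.* suc i ℕ.∸ 1)) % (4 ℕ.* k)
        to₂ : T (suc m % 4 ≡ᵇ 2) → suc m % 4 ≡ 2
        to₂ = ℕₚ.≡ᵇ⇒≡ (suc m % 4) 2
        to₀ : T (rem ≡ᵇ 0) → rem ≡ 0
        to₀ = ℕₚ.≡ᵇ⇒≡ rem 0
        to₊ : T (rem ≡ᵇ c₊) → rem ≡ A
        to₊ t = ≡.trans (ℕₚ.≡ᵇ⇒≡ rem c₊ t) residue₊
        to₋ : T (rem ≡ᵇ c₋) → rem ≡ B
        to₋ t = ≡.trans (ℕₚ.≡ᵇ⇒≡ rem c₋ t) residue₋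
        lem : ∀ k i → suc (2 ℕ.* (k ℕ.+ i)) ≡ 2 ℕ.* k ℕ.+ suc (2 ℕ.* i)
        lem = solve-∀
        absurd-0 : suc m % 4 ≡ 2 → ¬ (rem ≡ 0)
        absurd-0 eq rem≡0 = contradiction (≡.trans (≡.sym eq) (≡.trans (≡.sym (%4k-%4 k (suc m))) (≡.cong (_% 4) rem≡0))) λ ()
        absurd-odd : ∀ l {v} → suc (2 ℕ.* l) ≡ v → suc m % 4 ≡ 2 → ¬ (rem ≡ v)
        absurd-odd l ≡.refl eq rem≡v = odd%4≢2 l (≡.trans (≡.cong (_% 4) (≡.sym rem≡v)) (≡.trans (%4k-%4 k (suc m)) eq))
        A≢B : ¬ (A ≡ B)
        A≢B A≡B = ℕₚ.<⇒≢ (≡.subst (B <_) (lem₂ i d) (ℕₚ.m<m+n B (s≤s z≤n))) (≡.sym A≡B)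
          where
          lem₂ : ∀ i d → suc (2 ℕ.* d) ℕ.+ suc (suc (4 ℕ.* i)) ≡ 2 ℕ.* suc (i ℕ.+ d) ℕ.+ suc (2 ℕ.* i)
          lem₂ = solve-∀

    module _ (t : ℕ) (N≤t : N ℕ.+ N ≤ t) where
      private
        n M : ℕ
        n = k ℕ.* t
        -- The length 4kt consists of whole blocks for the modulus 4 and for the modulus 4k.
        M = 4 ℕ.* n

        N≤t′ : N ≤ t
        N≤t′ = ℕₚ.≤-trans (ℕₚ.m≤m+n N N) N≤t

        t≤n : t ≤ n
        t≤n = ℕₚ.m≤n*m t k

        M≡4kt : M ≡ 4 ℕ.* k ℕ.* t
        M≡4kt = ≡.sym (ℕₚ.*-assoc 4 k t)

        H₂ : Π M h₂ ≈ Π n (λ s → x (2 ℕ.* suc (2 ℕ.* s)))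
        H₂ = trans (Π-residue 4 {1} 2 (s≤s (s≤s z≤n)) ≡.refl n x) (Π-cong n (λ s _ → reflexive (≡.cong x (lem s))))
          where
          lem : ∀ s → suc (4 ℕ.* s ℕ.+ 1) ≡ 2 ℕ.* suc (2 ℕ.* s)
          lem = solve-∀

        progression : ∀ {r m c} → suc r ≡ m → m ≤ 4 ℕ.* k → m % (4 ℕ.* k) ≡ c →
          Π M (λ m → if suc m % (4 ℕ.* k) ≡ᵇ c then x (suc m) else 1#) ≈ Π t (λ s → x (m ℕ.+ D ℕ.* s))
        progression {r} {m} {c} ≡.refl m≤4k eq = trans (reflexive (≡.cong (λ l → Π l (λ m → if suc m % (4 ℕ.* k) ≡ᵇ c then x (suc m) else 1#)) M≡4kt))
          (trans (Π-residue (4 ℕ.* k) c m≤4k eq t x)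
            (Π-cong t (λ s _ → reflexive (≡.cong x (≡.cong suc (≡.trans (ℕₚ.+-comm _ r) (≡.cong (λ l → r ℕ.+ l ℕ.* s) (≡.sym D≡4k))))))))

        large : ∀ m {s} → N ≤ s → N ≤ m ℕ.+ D ℕ.* s
        large m {s} N≤s = ℕₚ.≤-trans N≤s (ℕₚ.≤-trans (m≤D*m s) (ℕₚ.m≤n+m _ m))

        H₀ : Π M h₀ ≈ p N
        H₀ = trans (progression ≡.refl ℕₚ.≤-refl (n%n≡0 (4 ℕ.* k)))
          (trans (Π-cong t (λ s _ → reflexive (≡.cong x (≡.trans (≡.cong (ℕ._+ D ℕ.* s) (≡.sym D≡4k)) (≡.sym (ℕₚ.*-suc D s))))))
            (Π-stable N≤t′ (λ s N≤s → 1-X≈1 (ℕₚ.≤-trans N≤s (ℕₚ.≤-trans (ℕₚ.n≤1+n s) (m≤D*m (suc s)))))))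

        H₊ : Π M h₊ ≈ Π (N ℕ.+ N) (λ s → x (A ℕ.+ D ℕ.* s))
        H₊ = trans (progression (lem k i) (ℕₚ.<⇒≤ A<4k) (≡.trans (m<n⇒m%n≡m A<4k) (≡.sym residue₊)))
          (Π-stable N≤t (λ s N≤s → 1-X≈1 (large A (ℕₚ.≤-trans (ℕₚ.m≤m+n N N) N≤s))))
          where
          lem : ∀ k i → suc (2 ℕ.* (k ℕ.+ i)) ≡ 2 ℕ.* k ℕ.+ suc (2 ℕ.* i)
          lem = solve-∀

        H₋ : Π M h₋ ≈ Π N (λ s → x (B ℕ.+ D ℕ.* s))
        H₋ = trans (progression ≡.refl (ℕₚ.<⇒≤ B<4k) (≡.trans (m<n⇒m%n≡m B<4k) (≡.sym residue₋)))
          (Π-stable N≤t′ (λ s N≤s → 1-X≈1 (large B N≤s)))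

        all : Carrier
        all = Π M (λ m → x (suc m))

        all⁻¹ : Carrier
        all⁻¹ = Π M (λ m → ι (suc m))

        all-inverse : all * all⁻¹ ≈ 1#
        all-inverse = trans (sym (Π-* M _ _)) (Π-1 M (λ m _ → ι-inverse (suc m) (s≤s z≤n)))

        factor-all : Π M factor * all ≈ Π n (λ s → x (2 ℕ.* suc (2 ℕ.* s))) * (p N * (Π (N ℕ.+ N) (λ s → x (A ℕ.+ D ℕ.* s)) * Π N (λ s → x (B ℕ.+ D ℕ.* s))))
        factor-all = begin
          Π M factor * all
            ≈⟨ sym (Π-* M _ _) ⟩
          Π M (λ m → factor m * x (suc m))
            ≈⟨ Π-cong M (λ m _ → factor-cancel m) ⟩
          Π M (λ m → h₂ m * (h₀ m * (h₊ m * h₋ m)))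
            ≈⟨ trans (Π-* M _ _) (*-congˡ (trans (Π-* M _ _) (*-congˡ (Π-* M _ _)))) ⟩
          Π M h₂ * (Π M h₀ * (Π M h₊ * Π M h₋))
            ≈⟨ *-cong H₂ (*-cong H₀ (*-cong H₊ H₋)) ⟩
          _ ∎

        -- (1 + q^{2m-1}) (1 - q^{2m-1}) = 1 - q^{4m-2}
        F-all : F (2 ℕ.* n) * all ≈ Π n (λ s → x (2 ℕ.* suc (2 ℕ.* s)))
        F-all = begin
          F (2 ℕ.* n) * all
            ≈⟨ *-congˡ (trans (reflexive (≡.cong (λ l → Π l (λ m → x (suc m))) (ℕₚ.*-assoc 2 2 n))) (Π-blocks 2 (2 ℕ.* n) _)) ⟩
          F (2 ℕ.* n) * Π (2 ℕ.* n) (λ s → 1# * x (suc (2 ℕ.* s ℕ.+ 0)) * x (suc (2 ℕ.* s ℕ.+ 1)))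
            ≈⟨ sym (Π-* (2 ℕ.* n) _ _) ⟩
          Π (2 ℕ.* n) (λ s → (1# + X (suc (2 ℕ.* s))) * ι (2 ℕ.* suc s) * (1# * x (suc (2 ℕ.* s ℕ.+ 0)) * x (suc (2 ℕ.* s ℕ.+ 1))))
            ≈⟨ Π-cong (2 ℕ.* n) (λ s _ → term s) ⟩
          Π (2 ℕ.* n) (λ s → x (2 ℕ.* suc (2 ℕ.* s)))
            ≈⟨ Π-stable (ℕₚ.m≤n*m n 2) (λ l n≤l → 1-X≈1 (ℕₚ.≤-trans N≤t′ (ℕₚ.≤-trans t≤n (ℕₚ.≤-trans n≤l (ℕₚ.≤-trans (ℕₚ.m≤n*m l 2) (ℕₚ.≤-trans (ℕₚ.n≤1+n _) (ℕₚ.m≤n*m _ 2))))))) ⟩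
          Π n (λ s → x (2 ℕ.* suc (2 ℕ.* s))) ∎
          where
          term : ∀ s → (1# + X (suc (2 ℕ.* s))) * ι (2 ℕ.* suc s) * (1# * x (suc (2 ℕ.* s ℕ.+ 0)) * x (suc (2 ℕ.* s ℕ.+ 1))) ≈ x (2 ℕ.* suc (2 ℕ.* s))
          term s = begin
            (1# + u) * v * (1# * x (suc (2 ℕ.* s ℕ.+ 0)) * x (suc (2 ℕ.* s ℕ.+ 1)))
              ≡⟨ ≡.cong₂ (λ y z → (1# + u) * v * (1# * x y * x z)) (≡.cong suc (ℕₚ.+-identityʳ (2 ℕ.* s))) (lem₁ s) ⟩
            (1# + u) * v * (1# * (1# - u) * x (2 ℕ.* suc s))
              ≈⟨ solve 3 (λ u v w → (con (+ 1) :+ u) :* v :* (con (+ 1) :* (con (+ 1) :- u) :* w) := (con (+ 1) :- u :* u) :* (w :* v)) refl _ _ _ ⟩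
            (1# - u * u) * (x (2 ℕ.* suc s) * v)
              ≈⟨ trans (*-congˡ (ι-inverse (2 ℕ.* suc s) (s≤s z≤n))) (*-identityʳ _) ⟩
            1# - u * u
              ≈⟨ +-congˡ (-‿cong (sym (X-split _ _ (lem₂ s)))) ⟩
            x (2 ℕ.* suc (2 ℕ.* s)) ∎
            where
            u v : Carrier
            u = X (suc (2 ℕ.* s))
            v = ι (2 ℕ.* suc s)
            lem₁ : ∀ s → suc (2 ℕ.* s ℕ.+ 1) ≡ 2 ℕ.* suc s
            lem₁ = solve-∀
            lem₂ : ∀ s → 2 ℕ.* suc (2 ℕ.* s) ≡ suc (2 ℕ.* s) ℕ.+ suc (2 ℕ.* s)
            lem₂ = solve-∀

      -- Multiplication by all factors 1 - q^m leaves the product over the excluded m: the class 2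
      -- modulo 4 is accounted for by `F-all`, the other three by `triple-product`.
      factor-theta : ∀ K (N≤K : N ≤ K) → 1 ≤ K → Π M factor ≈ F (2 ℕ.* n) * theta K N≤K
      factor-theta K N≤K 1≤K = begin
        Π M factor
          ≈⟨ trans (sym (*-identityʳ _)) (*-congˡ (sym all-inverse)) ⟩
        Π M factor * (all * all⁻¹)
          ≈⟨ trans (sym (*-assoc _ _ _)) (*-congʳ (trans factor-all (*-cong (sym F-all) (sym (triple-product K N≤K 1≤K))))) ⟩
        F (2 ℕ.* n) * all * theta K N≤K * all⁻¹
          ≈⟨ solve 4 (λ f a t b → f :* a :* t :* b := f :* t :* (a :* b)) refl _ _ _ _ ⟩
        F (2 ℕ.* n) * theta K N≤K * (all * all⁻¹)
          ≈⟨ trans (*-congˡ all-inverse) (*-identityʳ _) ⟩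
        F (2 ℕ.* n) * theta K N≤K ∎

    F-stable : ∀ {L} → N ≤ L → F L ≈ F N
    F-stable N≤L = Π-stable N≤L (λ l N≤l → trans (*-cong (1+X≈1 (big l N≤l)) (ι≈1 (s≤s z≤n) (ℕₚ.≤-trans N≤l (ℕₚ.≤-trans (ℕₚ.n≤1+n l) (ℕₚ.m≤n*m (suc l) 2))))) (*-identityˡ 1#))
      where
      big : ∀ l → N ≤ l → N ≤ suc (2 ℕ.* l)
      big l N≤l = ℕₚ.≤-trans N≤l (ℕₚ.≤-trans (ℕₚ.m≤n*m l 2) (ℕₚ.n≤1+n _))

    -- The first omitted factor belongs to q^(M+1), so N = M + 1 is still allowed. This is exactly
    -- what `prodPS` needs, whose coefficient n uses n factors.
    factor-stable : ∀ {M M′} → N ≤ suc M → M ≤ M′ → Π M′ factor ≈ Π M factor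
    factor-stable N≤1+M M≤M′ = Π-stable M≤M′ (λ l M≤l → trivial (allowed k (suc i) (suc l)) (ι≈1 (s≤s z≤n) (ℕₚ.≤-trans N≤1+M (s≤s M≤l))))
      where
      trivial : ∀ b {y} → y ≈ 1# → (if b then y else 1#) ≈ 1#
      trivial true  eq = eq
      trivial false eq = refl

    C-zero : ∀ K (N≤K : N ≤ K) → 1 ≤ K → ∀ L → N ≤ L → ClosedForm.C (F L) K k 0 i d ≈ Π N factor
    C-zero K N≤K 1≤K L N≤L = begin
      ClosedForm.C (F L) K k 0 i d
        ≈⟨ Σ-cong K (λ μ _ → term μ) ⟩
      Σ K (λ μ → F L * (sgn μ * (X (e A μ) - X (e B (suc μ)))))
        ≈⟨ Σ-*ˡ K _ _ ⟩
      F L * theta K N≤K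
        ≈⟨ *-congʳ (trans (F-stable N≤L) (sym (F-stable (ℕₚ.≤-trans N≤n (ℕₚ.m≤n*m n 2))))) ⟩
      F (2 ℕ.* n) * theta K N≤K
        ≈⟨ sym (factor-theta t ℕₚ.≤-refl K N≤K 1≤K) ⟩
      Π (4 ℕ.* n) factor
        ≈⟨ factor-stable (ℕₚ.n≤1+n N) (ℕₚ.≤-trans N≤n (ℕₚ.m≤n*m n 4)) ⟩
      Π N factor ∎
      where
      open ClosedForm (F L)
      t n : ℕ
      t = N ℕ.+ N
      n = k ℕ.* t
      N≤n : N ≤ n
      N≤n = ℕₚ.≤-trans (ℕₚ.m≤m+n N N) (ℕₚ.m≤n*m t k)
      term : ∀ μ → a k 0 i μ - b k 0 d μ ≈ F L * (sgn μ * (X (e A μ) - X (e B (suc μ))))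
      term μ = begin
        sgn μ * (ρ 0 μ * (1# + X (suc (2 ℕ.* (μ ℕ.+ 0))))) * X (α k 0 i μ) - sgn μ * (ρ 0 μ * (1# + X (suc (2 ℕ.* μ)))) * X (β k 0 d μ)
          ≡⟨ ≡.cong (λ l → sgn μ * (ρ 0 μ * (1# + X (suc (2 ℕ.* l)))) * X (α k 0 i μ) - sgn μ * (ρ 0 μ * (1# + X (suc (2 ℕ.* μ)))) * X (β k 0 d μ)) (ℕₚ.+-identityʳ μ) ⟩
        sgn μ * (ρ 0 μ * (1# + X (suc (2 ℕ.* μ)))) * X (α k 0 i μ) - sgn μ * (ρ 0 μ * (1# + X (suc (2 ℕ.* μ)))) * X (β k 0 d μ)
          ≈⟨ +-cong (*-cong (*-congˡ (ρ-zero μ)) (reflexive (≡.cong X (≡.sym (e-A μ))))) (-‿cong (*-cong (*-congˡ (ρ-zero μ)) (reflexive (≡.cong X (≡.sym (e-B μ)))))) ⟩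
        sgn μ * F L * X (e A μ) - sgn μ * F L * X (e B (suc μ))
          ≈⟨ solve 4 (λ σ f x y → σ :* f :* x :- σ :* f :* y := f :* (σ :* (x :- y))) refl _ _ _ _ ⟩
        F L * (sgn μ * (X (e A μ) - X (e B (suc μ)))) ∎

-- Power series modulo q^N as a commutative ring.

infixl 6 _+ᴾ_
infix  8 -ᴾ_

_+ᴾ_ : PS → PS → PS
(f +ᴾ g) n = f n ℤ.+ g n

-ᴾ_ : PS → PS
(-ᴾ f) n = ℤ.- f n

zeroPS : PS
zeroPS _ = + 0

tail : PS → PS
tail f n = f (suc n)

mulPS-zero : ∀ f g → mulPS f g 0 ≡ f 0 ℤ.* g 0
mulPS-zero f g = ℤₚ.+-identityʳ _

-- This replaces the convolution sum by a recursion, from which the ring laws follow by induction on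
-- the coefficient index.
mulPS-suc : ∀ f g n → mulPS f g (suc n) ≡ f 0 ℤ.* g (suc n) ℤ.+ mulPS (tail f) g n
mulPS-suc f g n = ≡.cong (λ xs → f 0 ℤ.* g (suc n) ℤ.+ sumℤ xs)
  (≡.trans (map-applyUpTo suc (λ m → f m ℤ.* g (suc n ∸ m)) (suc n))
    (≡.sym (map-applyUpTo (λ m → m) (λ m → f (suc m) ℤ.* g (n ∸ m)) (suc n))))

mulPS-cong : ∀ n {f f′ g g′} → (∀ m → m ≤ n → f m ≡ f′ m) → (∀ m → m ≤ n → g m ≡ g′ m) → mulPS f g n ≡ mulPS f′ g′ n
mulPS-cong zero    {f} {f′} {g} {g′} ff gg = ≡.trans (mulPS-zero f g) (≡.trans (≡.cong₂ ℤ._*_ (ff 0 z≤n) (gg 0 z≤n)) (≡.sym (mulPS-zero f′ g′)))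
mulPS-cong (suc n) {f} {f′} {g} {g′} ff gg = ≡.trans (mulPS-suc f g n) (≡.trans
  (≡.cong₂ ℤ._+_ (≡.cong₂ ℤ._*_ (ff 0 z≤n) (gg (suc n) ℕₚ.≤-refl))
    (mulPS-cong n (λ m m≤n → ff (suc m) (s≤s m≤n)) (λ m m≤n → gg m (ℕₚ.m≤n⇒m≤1+n m≤n))))
  (≡.sym (mulPS-suc f′ g′ n)))

mulPS-distribʳ : ∀ h f g → mulPS (f +ᴾ g) h ≗ mulPS f h +ᴾ mulPS g h
mulPS-distribʳ h f g zero    = ≡.trans (mulPS-zero (f +ᴾ g) h) (≡.trans (ℤₚ.*-distribʳ-+ (h 0) (f 0) (g 0))
  (≡.sym (≡.cong₂ ℤ._+_ (mulPS-zero f h) (mulPS-zero g h))))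
mulPS-distribʳ h f g (suc n) = ≡.trans (mulPS-suc (f +ᴾ g) h n) (≡.trans
  (≡.cong (λ x → (f 0 ℤ.+ g 0) ℤ.* h (suc n) ℤ.+ x) (mulPS-distribʳ h (tail f) (tail g) n))
  (≡.trans (solve 5 (λ x y z u v → (x :+ y) :* z :+ (u :+ v) := (x :* z :+ u) :+ (y :* z :+ v)) ≡.refl (f 0) (g 0) (h (suc n)) (mulPS (tail f) h n) (mulPS (tail g) h n))
    (≡.sym (≡.cong₂ ℤ._+_ (mulPS-suc f h n) (mulPS-suc g h n)))))
  where open ℤ-Solver.+-*-Solver

mulPS-scale : ∀ x f g → mulPS (λ m → x ℤ.* f m) g ≗ λ n → x ℤ.* mulPS f g n
mulPS-scale x f g zero    = ≡.trans (mulPS-zero (λ m → x ℤ.* f m) g) (≡.trans (ℤₚ.*-assoc x (f 0) (g 0)) (≡.cong (x ℤ.*_) (≡.sym (mulPS-zero f g))))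
mulPS-scale x f g (suc n) = ≡.trans (mulPS-suc (λ m → x ℤ.* f m) g n) (≡.trans
  (≡.cong (λ y → x ℤ.* f 0 ℤ.* g (suc n) ℤ.+ y) (mulPS-scale x (tail f) g n))
  (≡.trans (solve 4 (λ x y z u → x :* y :* z :+ x :* u := x :* (y :* z :+ u)) ≡.refl x (f 0) (g (suc n)) (mulPS (tail f) g n))
    (≡.cong (x ℤ.*_) (≡.sym (mulPS-suc f g n)))))
  where open ℤ-Solver.+-*-Solver

-- The mirror image of `mulPS-suc`; commutativity plays one against the other.
mulPS-tailʳ : ∀ f g n → mulPS f g (suc n) ≡ mulPS f (tail g) n ℤ.+ f (suc n) ℤ.* g 0
mulPS-tailʳ f g zero    = ≡.trans (mulPS-suc f g 0) (≡.cong₂ ℤ._+_ (≡.sym (mulPS-zero f (tail g))) (mulPS-zero (tail f) g))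
mulPS-tailʳ f g (suc n) = ≡.trans (mulPS-suc f g (suc n)) (≡.trans
  (≡.cong (λ x → f 0 ℤ.* g (suc (suc n)) ℤ.+ x) (mulPS-tailʳ (tail f) g n))
  (≡.trans (≡.sym (ℤₚ.+-assoc (f 0 ℤ.* g (suc (suc n))) (mulPS (tail f) (tail g) n) (f (suc (suc n)) ℤ.* g 0))) (≡.cong (λ x → x ℤ.+ f (suc (suc n)) ℤ.* g 0) (≡.sym (mulPS-suc f (tail g) n)))))

mulPS-comm : ∀ f g → mulPS f g ≗ mulPS g f
mulPS-comm f g zero    = ≡.trans (mulPS-zero f g) (≡.trans (ℤₚ.*-comm (f 0) (g 0)) (≡.sym (mulPS-zero g f)))
mulPS-comm f g (suc n) = ≡.trans (mulPS-suc f g n) (≡.trans (≡.cong₂ ℤ._+_ (ℤₚ.*-comm (f 0) (g (suc n))) (mulPS-comm (tail f) g n))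
  (≡.trans (ℤₚ.+-comm (g (suc n) ℤ.* f 0) (mulPS g (tail f) n)) (≡.sym (mulPS-tailʳ g f n))))

mulPS-assoc : ∀ f g h → mulPS (mulPS f g) h ≗ mulPS f (mulPS g h)
mulPS-assoc f g h zero    = ≡.trans (≡.trans (mulPS-zero (mulPS f g) h) (≡.cong (ℤ._* h 0) (mulPS-zero f g)))
  (≡.trans (ℤₚ.*-assoc (f 0) (g 0) (h 0)) (≡.sym (≡.trans (mulPS-zero f (mulPS g h)) (≡.cong (f 0 ℤ.*_) (mulPS-zero g h)))))
mulPS-assoc f g h (suc n) = ≡.trans (mulPS-suc (mulPS f g) h n) (≡.trans
  (≡.cong₂ ℤ._+_ (≡.cong (ℤ._* h (suc n)) (mulPS-zero f g)) (≡.trans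
    (mulPS-cong n {g′ = h} (λ m _ → mulPS-suc f g m) (λ _ _ → ≡.refl))
    (≡.trans (mulPS-distribʳ h (λ m → f 0 ℤ.* tail g m) (mulPS (tail f) g) n)
      (≡.cong₂ ℤ._+_ (mulPS-scale (f 0) (tail g) h n) (mulPS-assoc (tail f) g h n)))))
  (≡.trans (solve 5 (λ x y z u v → x :* y :* z :+ (x :* u :+ v) := x :* (y :* z :+ u) :+ v) ≡.refl (f 0) (g 0) (h (suc n)) (mulPS (tail g) h n) (mulPS (tail f) (mulPS g h) n))
    (≡.sym (≡.trans (mulPS-suc f (mulPS g h) n) (≡.cong (λ x → f 0 ℤ.* x ℤ.+ mulPS (tail f) (mulPS g h) n) (mulPS-suc g h n))))))
  where open ℤ-Solver.+-*-Solver

mulPS-zeroˡ : ∀ f → mulPS zeroPS f ≗ zeroPS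
mulPS-zeroˡ f zero    = ≡.refl
mulPS-zeroˡ f (suc n) = ≡.trans (mulPS-suc zeroPS f n) (≡.trans (ℤₚ.+-identityˡ _) (mulPS-zeroˡ f n))

mulPS-identityˡ : ∀ f → mulPS onePS f ≗ f
mulPS-identityˡ f zero    = ≡.trans (mulPS-zero onePS f) (ℤₚ.*-identityˡ (f 0))
mulPS-identityˡ f (suc n) = ≡.trans (mulPS-suc onePS f n) (≡.trans (≡.cong₂ ℤ._+_ (ℤₚ.*-identityˡ (f (suc n))) (mulPS-zeroˡ f n)) (ℤₚ.+-identityʳ _))

-- ℤ[[q]] / (q^N): the carrier and the operations do not depend on N, only the equality does.
truncatedRing : ℕ → CommutativeRing 0ℓ 0ℓ
truncatedRing N = record
  { Carrier = PS
  ; _≈_ = λ f g → ∀ n → n < N → f n ≡ g n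
  ; _+_ = _+ᴾ_
  ; _*_ = mulPS
  ; -_  = -ᴾ_
  ; 0#  = zeroPS
  ; 1#  = onePS
  ; isCommutativeRing = record
    { isRing = record
      { +-isAbelianGroup = record
        { isGroup = record
          { isMonoid = record
            { isSemigroup = record
              { isMagma = record
                { isEquivalence = record
                  { refl  = λ n _ → ≡.refl
                  ; sym   = λ eq n n<N → ≡.sym (eq n n<N)
                  ; trans = λ eq eq′ n n<N → ≡.trans (eq n n<N) (eq′ n n<N)
                  }
                ; ∙-cong = λ eq eq′ n n<N → ≡.cong₂ ℤ._+_ (eq n n<N) (eq′ n n<N)
                }
              ; assoc = λ f g h n _ → ℤₚ.+-assoc (f n) (g n) (h n)
              }
            ; identity = (λ f n _ → ℤₚ.+-identityˡ (f n)) , (λ f n _ → ℤₚ.+-identityʳ (f n))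
            }
          ; inverse = (λ f n _ → ℤₚ.+-inverseˡ (f n)) , (λ f n _ → ℤₚ.+-inverseʳ (f n))
          ; ⁻¹-cong = λ eq n n<N → ≡.cong ℤ.-_ (eq n n<N)
          }
        ; comm = λ f g n _ → ℤₚ.+-comm (f n) (g n)
        }
      ; *-cong = λ eq eq′ n n<N → mulPS-cong n (λ m m≤n → eq m (ℕₚ.≤-<-trans m≤n n<N)) (λ m m≤n → eq′ m (ℕₚ.≤-<-trans m≤n n<N))
      ; *-assoc = λ f g h n _ → mulPS-assoc f g h n
      ; *-identity = (λ f n _ → mulPS-identityˡ f n) , (λ f n _ → ≡.trans (mulPS-comm f onePS n) (mulPS-identityˡ f n))
      ; distrib = (λ f g h n _ → ≡.trans (mulPS-comm f (g +ᴾ h) n) (≡.trans (mulPS-distribʳ f g h n)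
                    (≡.cong₂ ℤ._+_ (mulPS-comm g f n) (mulPS-comm h f n))))
                , (λ f g h n _ → mulPS-distribʳ f g h n)
      }
    ; *-comm = λ f g n _ → mulPS-comm f g n
    }
  }

X : ℕ → PS
X zero          = onePS
X (suc m) zero    = + 0
X (suc m) (suc n) = X m n

X-suc-mul : ∀ m f n → mulPS (X (suc m)) f (suc n) ≡ mulPS (X m) f n
X-suc-mul m f n = ≡.trans (mulPS-suc (X (suc m)) f n) (ℤₚ.+-identityˡ _)

X-mul-+ : ∀ m f n → mulPS (X m) f (m ℕ.+ n) ≡ f n
X-mul-+ zero    f n = mulPS-identityˡ f n
X-mul-+ (suc m) f n = ≡.trans (X-suc-mul m f (m ℕ.+ n)) (X-mul-+ m f n)

X-mul-< : ∀ m f {n} → n < m → mulPS (X m) f n ≡ + 0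
X-mul-< (suc m) f {zero}  _         = mulPS-zero (X (suc m)) f
X-mul-< (suc m) f {suc n} (s≤s n<m) = ≡.trans (X-suc-mul m f n) (X-mul-< m f n<m)

X-+ : ∀ m n → X (m ℕ.+ n) ≗ mulPS (X m) (X n)
X-+ zero    n l       = ≡.sym (mulPS-identityˡ (X n) l)
X-+ (suc m) n zero    = ≡.sym (mulPS-zero (X (suc m)) (X n))
X-+ (suc m) n (suc l) = ≡.trans (X-+ m n l) (≡.sym (X-suc-mul m (X n) l))

X-< : ∀ m {n} → n < m → X m n ≡ + 0
X-< (suc m) {zero}  _         = ≡.refl
X-< (suc m) {suc n} (s≤s n<m) = X-< m n<m

-- Below m the geometric series agrees with 1 and its shift by m is 0; from m on, its m-periodicity
-- makes the two cancel.
geomInv-inverse : ∀ m → 1 ≤ m → mulPS (onePS +ᴾ (-ᴾ X m)) (geomInv m) ≗ onePS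
geomInv-inverse m@(suc m′) _ n = begin
  mulPS (onePS +ᴾ (-ᴾ X m)) g n
    ≡⟨ mulPS-distribʳ g onePS (-ᴾ X m) n ⟩
  mulPS onePS g n ℤ.+ mulPS (-ᴾ X m) g n
    ≡⟨ ≡.cong₂ ℤ._+_ (mulPS-identityˡ g n) (≡.trans (mulPS-cong n {g = g} (λ l _ → ≡.sym (ℤₚ.-1*i≡-i (X m l))) (λ _ _ → ≡.refl)) (mulPS-scale -[1+ 0 ] (X m) g n)) ⟩
  g n ℤ.+ -[1+ 0 ] ℤ.* mulPS (X m) g n
    ≡⟨ coefficient n (ℕₚ.<-≤-connex n m) ⟩
  onePS n ∎
  where
  open ≡.≡-Reasoning
  g : PS
  g = geomInv m
  below : ∀ n → n < m → g n ≡ onePS n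
  below zero    _   = ≡.refl
  below (suc n) n<m = ≡.cong (λ x → if x ≡ᵇ 0 then + 1 else + 0) (m<n⇒m%n≡m n<m)
  coefficient : ∀ n → n < m ⊎ m ≤ n → g n ℤ.+ -[1+ 0 ] ℤ.* mulPS (X m) g n ≡ onePS n
  coefficient n (inj₁ n<m) = ≡.trans (≡.cong₂ (λ x y → x ℤ.+ -[1+ 0 ] ℤ.* y) (below n n<m) (X-mul-< m g n<m)) (ℤₚ.+-identityʳ _)
  coefficient n (inj₂ m≤n) = ≡.subst (λ l → g l ℤ.+ -[1+ 0 ] ℤ.* mulPS (X m) g l ≡ onePS l) (ℕₚ.m+[n∸m]≡n m≤n) (begin
    g (m ℕ.+ l) ℤ.+ -[1+ 0 ] ℤ.* mulPS (X m) g (m ℕ.+ l)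
      ≡⟨ ≡.cong₂ (λ x y → (if x ≡ᵇ 0 then + 1 else + 0) ℤ.+ -[1+ 0 ] ℤ.* y) (≡.trans (≡.cong (_% m) (ℕₚ.+-comm m l)) ([m+n]%n≡m%n l m)) (X-mul-+ m g l) ⟩
    g l ℤ.+ -[1+ 0 ] ℤ.* g l
      ≡⟨ ≡.trans (≡.cong (λ x → g l ℤ.+ x) (ℤₚ.-1*i≡-i (g l))) (ℤₚ.+-inverseʳ (g l)) ⟩
    + 0 ∎)
    where
    l : ℕ
    l = n ∸ m

-- The closed form as a concrete power series.

open Series _+ᴾ_ mulPS -ᴾ_ zeroPS onePS X geomInv using (Π; F; module Terms)

truncation : ∀ N → NilpotentRing 0ℓ 0ℓ N
truncation N = record
  { commutativeRing = truncatedRing N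
  ; X         = X
  ; X-0       = λ n _ → ≡.refl
  ; X-+       = λ m n l _ → X-+ m n l
  ; X-N       = λ n n<N → X-< N n<N
  ; ι         = geomInv
  ; ι-inverse = λ m 1≤m n _ → geomInv-inverse m 1≤m n
  }

module Mod (N : ℕ) = Truncated (truncation N)

-- The modulus q^M also serves as the cut-off of the product F and of the sum over μ.
closed : ℕ → ℕ → ℕ → ℕ → ℕ → PS
closed M k j i d = Terms.C (F M) (suc M) k j i d

finProd-Π : ∀ N i d M → finProd (suc (i ℕ.+ d)) (suc i) M ≡ Π M (Mod.Base.factor N i d)
finProd-Π N i d zero    = ≡.refl
finProd-Π N i d (suc M) = ≡.cong (λ f → mulPS f (Mod.Base.factor N i d M)) (finProd-Π N i d M)

closed-zero : ∀ i d {n M} → n < M → closed M (suc (i ℕ.+ d)) 0 i d n ≡ prodPS (suc (i ℕ.+ d)) (suc i) n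
closed-zero i d {n} {M} n<M = begin
  closed M (suc (i ℕ.+ d)) 0 i d n
    ≡⟨ Mod.Base.C-zero M i d (suc M) (ℕₚ.n≤1+n M) (s≤s z≤n) M ℕₚ.≤-refl n n<M ⟩
  Π M (Mod.Base.factor M i d) n
    -- Passing through `finProd`, which knows no modulus, changes the modulus from q^M to q^(n+1);
    -- only there may the factors beyond n be dropped.
    ≡⟨ ≡.cong (λ f → f n) (≡.trans (≡.sym (finProd-Π M i d M)) (finProd-Π (suc n) i d M)) ⟩
  Π M (Mod.Base.factor (suc n) i d) n
    ≡⟨ Mod.Base.factor-stable (suc n) i d ℕₚ.≤-refl (ℕₚ.<⇒≤ n<M) n ℕₚ.≤-refl ⟩
  Π n (Mod.Base.factor (suc n) i d) n
    ≡⟨ ≡.cong (λ f → f n) (finProd-Π (suc n) i d n) ⟨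
  prodPS (suc (i ℕ.+ d)) (suc i) n ∎
  where open ≡.≡-Reasoning

closed-recursion : ∀ i d j {n M} → n < M → let k = suc (suc (i ℕ.+ d)) in
  closed M k j d (suc i) n ℤ.- closed M k j (suc d) i n ≡
  mulPS (X (2 ℕ.* (suc j ℕ.* suc i))) (closed M k (suc j) (suc i) d) n ℤ.+
  mulPS (X (suc (2 ℕ.* (j ℕ.+ suc j ℕ.* i)))) (closed M k (suc j) i (suc d)) n
closed-recursion i d j {n} {M} n<M = Mod.ClosedForm.C-recursion M (F M) (suc M) (ℕₚ.n≤1+n M) i d j n n<M

closed-edge : ∀ k j {n M} → n < M → closed M (suc k) (suc j) 0 k n ≡ closed M (suc k) j k 0 n
closed-edge k j {n} {M} n<M = Mod.ClosedForm.C-edge M (F M) (suc M) (ℕₚ.n≤1+n M) k j n n<M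

closed≈1 : ∀ k j i d {n M} → n < suc (2 ℕ.* j) → suc (2 ℕ.* j) ≤ M → closed M (suc k) j i d n ≡ onePS n
closed≈1 k j i d {n} {M} n<2j+1 2j+1≤M = Mod.C≈1 (suc (2 ℕ.* j)) M (suc M) (ℕₚ.m≤n⇒m≤1+n 2j+1≤M) (s≤s z≤n) k j i d
  (ℕₚ.≤-trans (ℕₚ.m≤n*m j 2) (ℕₚ.≤-trans (ℕₚ.n≤1+n _) 2j+1≤M)) ℕₚ.≤-refl n n<2j+1

-- From the closed form to the Laurent series of the recursion.

fromPS-cong : ∀ {f g z N} → ∣ z ∣ < N → (∀ {n} → n < N → f n ≡ g n) → fromPS f z ≡ fromPS g z
fromPS-cong {z = + n}      n<N eq = eq n<N
fromPS-cong {z = -[1+ n ]} _   _  = ≡.refl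

-- This trades division by q^e for multiplication. A negative z means l < e, where the product has
-- no coefficient either.
fromPS-X : ∀ e f z l → z ℤ.+ + e ≡ + l → mulPS (X e) f l ≡ fromPS f z
fromPS-X e f (+ n)    l eq = ≡.trans (≡.cong (mulPS (X e) f) (ℤₚ.+-injective (≡.trans (≡.sym eq) (ℤₚ.+-comm (+ n) (+ e))))) (X-mul-+ e f n)
fromPS-X e f -[1+ n ] l eq = X-mul-< e f (≡.subst (l <_) (≡.sym e≡) (ℕₚ.m<m+n l (s≤s z≤n)))
  where
  open ℤ-Solver.+-*-Solver
  e≡ : e ≡ l ℕ.+ suc n
  e≡ = ℤₚ.+-injective (≡.trans (solve 2 (λ e n → e := (:- n :+ e) :+ n) ≡.refl (+ e) (+ suc n)) (≡.cong (λ x → x ℤ.+ + suc n) eq))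

-- Dividing by q^{2(j+1)i} costs that many coefficients, hence the growth of the required precision.
row-closed : ∀ {k} j {E} →
  (∀ i d → suc (i ℕ.+ d) ≡ k → ∀ z M → ∣ z ∣ ℕ.+ E < M → level k j (suc i) z ≡ fromPS (closed M k j i d) z) →
  ∀ i d → suc (i ℕ.+ d) ≡ k → ∀ z M → ∣ z ∣ ℕ.+ (E ℕ.+ 2 ℕ.* (suc j ℕ.* i)) < M →
  level k (suc j) (suc i) z ≡ fromPS (closed M k (suc j) i d) z
row-closed j {E} prev zero d ≡.refl z M small = ≡.trans
  (prev d 0 (≡.cong suc (ℕₚ.+-identityʳ d)) z M (≡.subst (λ x → ∣ z ∣ ℕ.+ x < M) (≡.trans (≡.cong (λ x → E ℕ.+ 2 ℕ.* x) (ℕₚ.*-zeroʳ j)) (ℕₚ.+-identityʳ E)) small))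
  (≡.sym (fromPS-cong {z = z} (ℕₚ.≤-<-trans (ℕₚ.m≤m+n _ _) small) (closed-edge d j)))
row-closed j {E} prev (suc i) d ≡.refl z M small = begin
  (level k j (k ∸ suc (suc i) ℕ.+ 1) (z ℤ.- ℤ.- (+ e′)) ℤ.- level k j (k ∸ suc (suc i) ℕ.+ 2) (z ℤ.- ℤ.- (+ e′)))
    ℤ.- level k J (suc i) (z ℤ.- ℤ.- (+ 1))
    ≡⟨ ≡.cong₂ (λ m w → (level k j (m ℕ.+ 1) w ℤ.- level k j (m ℕ.+ 2) w) ℤ.- level k J (suc i) (z ℤ.- ℤ.- (+ 1))) (ℕₚ.m+n∸m≡n (suc (suc i)) d) w≡ ⟩
  (level k j (d ℕ.+ 1) w ℤ.- level k j (d ℕ.+ 2) w) ℤ.- level k J (suc i) (z ℤ.- ℤ.- (+ 1))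
    ≡⟨ ≡.cong₂ (λ x y → (x ℤ.- y) ℤ.- level k J (suc i) (z ℤ.- ℤ.- (+ 1))) prev₁ prev₂ ⟩
  (fromPS (closed M k j d (suc i)) w ℤ.- fromPS (closed M k j (suc d) i) w) ℤ.- level k J (suc i) (z ℤ.- ℤ.- (+ 1))
    -- At w = z + e the two products of `closed-recursion` contribute the coefficient of `C₁` at z
    -- and, since e₂ = e - 1, that of `C₂` at z + 1. The latter is what the recursion subtracts.
    ≡⟨ ≡.cong₂ ℤ._-_ (difference w ≡.refl) this ⟩
  (fromPS C₁ z ℤ.+ fromPS C₂ z₁) ℤ.- fromPS C₂ z₁
    ≡⟨ solve 2 (λ x y → (x :+ y) :- y := x) ≡.refl (fromPS C₁ z) (fromPS C₂ z₁) ⟩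
  fromPS C₁ z ∎
  where
  open ≡.≡-Reasoning
  open ℤ-Solver.+-*-Solver using (solve; _:+_; _:-_; _:=_; con)
  k J e e′ e₂ : ℕ
  k = suc (suc (i ℕ.+ d))
  J = suc j
  e = 2 ℕ.* (J ℕ.* suc i)
  e′ = 2 ℕ.* J ℕ.* suc i
  e₂ = suc (2 ℕ.* (j ℕ.+ J ℕ.* i))
  z₁ w : ℤ
  z₁ = z ℤ.+ + 1
  w = z ℤ.+ + e
  C₁ C₂ : PS
  C₁ = closed M k J (suc i) d
  C₂ = closed M k J i (suc d)
  e≡1+e₂ : e ≡ suc e₂
  e≡1+e₂ = lem i j
    where
    lem : ∀ i j → 2 ℕ.* (suc j ℕ.* suc i) ≡ suc (suc (2 ℕ.* (j ℕ.+ suc j ℕ.* i)))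
    lem = solve-∀
  w≡ : z ℤ.- ℤ.- (+ e′) ≡ w
  w≡ = ≡.cong (λ x → z ℤ.+ x) (≡.trans (ℤₚ.neg-involutive (+ e′)) (≡.cong +_ (ℕₚ.*-assoc 2 J (suc i))))
  w≡z₁+e₂ : z₁ ℤ.+ + e₂ ≡ w
  w≡z₁+e₂ = ≡.trans (ℤₚ.+-assoc z (+ 1) (+ e₂)) (≡.cong (λ x → z ℤ.+ + x) (≡.sym e≡1+e₂))
  ∣w∣≤ : ∣ w ∣ ≤ ∣ z ∣ ℕ.+ e
  ∣w∣≤ = ℤₚ.∣i+j∣≤∣i∣+∣j∣ z (+ e)
  small-w : ∣ w ∣ ℕ.+ E < M
  small-w = ℕₚ.≤-<-trans (ℕₚ.≤-trans (ℕₚ.+-monoˡ-≤ E ∣w∣≤) (ℕₚ.≤-reflexive (lem ∣ z ∣ e E))) small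
    where
    lem : ∀ z e E → z ℕ.+ e ℕ.+ E ≡ z ℕ.+ (E ℕ.+ e)
    lem = solve-∀
  w<M : ∣ w ∣ < M
  w<M = ℕₚ.≤-<-trans (ℕₚ.m≤m+n ∣ w ∣ E) small-w
  prev₁ : level k j (d ℕ.+ 1) w ≡ fromPS (closed M k j d (suc i)) w
  prev₁ = ≡.trans (≡.cong (λ m → level k j m w) (ℕₚ.+-comm d 1))
    (prev d (suc i) (lem i d) w M small-w)
    where
    lem : ∀ i d → suc (d ℕ.+ suc i) ≡ suc (suc (i ℕ.+ d))
    lem = solve-∀
  prev₂ : level k j (d ℕ.+ 2) w ≡ fromPS (closed M k j (suc d) i) w
  prev₂ = ≡.trans (≡.cong (λ m → level k j m w) (ℕₚ.+-comm d 2))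
    (prev (suc d) i (lem i d) w M small-w)
    where
    lem : ∀ i d → suc (suc d ℕ.+ i) ≡ suc (suc (i ℕ.+ d))
    lem = solve-∀
  -- Moving to z + 1 costs one coefficient, while lowering the index by one frees 2(j+1).
  small-z₁ : ∣ z₁ ∣ ℕ.+ (E ℕ.+ 2 ℕ.* (J ℕ.* i)) < M
  small-z₁ = ℕₚ.≤-<-trans (ℕₚ.≤-trans (ℕₚ.+-monoˡ-≤ _ (ℤₚ.∣i+j∣≤∣i∣+∣j∣ z (+ 1)))
    (ℕₚ.≤-trans (ℕₚ.m≤m+n _ (suc (2 ℕ.* j))) (ℕₚ.≤-reflexive (lem ∣ z ∣ E i j)))) small
    where
    lem : ∀ z E i j → z ℕ.+ 1 ℕ.+ (E ℕ.+ 2 ℕ.* (suc j ℕ.* i)) ℕ.+ suc (2 ℕ.* j) ≡ z ℕ.+ (E ℕ.+ 2 ℕ.* (suc j ℕ.* suc i))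
    lem = solve-∀
  this : level k J (suc i) (z ℤ.- ℤ.- (+ 1)) ≡ fromPS C₂ z₁
  this = row-closed j prev i (suc d) (≡.cong suc (ℕₚ.+-suc i d)) z₁ M small-z₁
  difference : ∀ w′ → w′ ≡ w →
    fromPS (closed M k j d (suc i)) w′ ℤ.- fromPS (closed M k j (suc d) i) w′ ≡ fromPS C₁ z ℤ.+ fromPS C₂ z₁
  difference (+ l) eq = ≡.trans
    (closed-recursion i d j (≡.subst (λ x → ∣ x ∣ < M) (≡.sym eq) w<M))
    (≡.cong₂ ℤ._+_ (fromPS-X e C₁ z l (≡.sym eq)) (fromPS-X e₂ C₂ z₁ l (≡.trans w≡z₁+e₂ (≡.sym eq))))
  -- If w is negative, so are z and z₁, and all coefficients involved are 0.
  difference -[1+ l ] eq = ≡.sym (≡.cong₂ ℤ._+_ (negative C₁ z e (≡.sym eq)) (negative C₂ z₁ e₂ (≡.trans w≡z₁+e₂ (≡.sym eq))))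
    where
    negative : ∀ f y m → y ℤ.+ + m ≡ -[1+ l ] → fromPS f y ≡ + 0
    negative f -[1+ _ ] m _ = ≡.refl

-- Bounding the index by k makes the loss uniform over a row, as `row-closed` expects one `E` for
-- the whole previous row.
precision : ℕ → ℕ → ℕ
precision k zero    = 0
precision k (suc j) = precision k j ℕ.+ 2 ℕ.* (suc j ℕ.* k)

level-closed : ∀ k j i d → suc (i ℕ.+ d) ≡ k → ∀ z M → ∣ z ∣ ℕ.+ precision k j < M →
  level k j (suc i) z ≡ fromPS (closed M k j i d) z
level-closed k zero    i d ≡.refl z M small =
  ≡.sym (fromPS-cong {z = z} (ℕₚ.≤-<-trans (ℕₚ.m≤m+n _ 0) small) (closed-zero i d))
level-closed k (suc j) i d eq z M small = row-closed j (level-closed k j) i d eq z M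
  (ℕₚ.≤-<-trans (ℕₚ.+-monoʳ-≤ ∣ z ∣ (ℕₚ.+-monoʳ-≤ (precision k j) (ℕₚ.*-monoʳ-≤ 2 (ℕₚ.*-monoʳ-≤ (suc j) i≤k)))) small)
  where
  i≤k : i ≤ k
  i≤k = ≡.subst (i ≤_) eq (ℕₚ.m≤n⇒m≤1+n (ℕₚ.m≤m+n i d))

level≈1 : ∀ k j {i} → 1 ≤ i → i ≤ k → ∀ z → z ℤ.< + suc (2 ℕ.* j) → level k j i z ≡ oneLS z
level≈1 k@(suc k′) j {suc i} _ i≤k z z<2j+1 = ≡.trans (level-closed k j i d i+d z M (ℕₚ.m<m+n _ (s≤s z≤n))) (one z z<2j+1)
  where
  d M : ℕ
  d = k ∸ suc i
  -- Large enough both for `level-closed` at z and for reading the closed form modulo q^(2j+1).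
  M = (∣ z ∣ ℕ.+ precision k j) ℕ.+ suc (2 ℕ.* j)
  i+d : suc (i ℕ.+ d) ≡ k
  i+d = ℕₚ.m+[n∸m]≡n i≤k
  one : ∀ z → z ℤ.< + suc (2 ℕ.* j) → fromPS (closed M k j i d) z ≡ oneLS z
  one (+ n)    (ℤ.+<+ n<) = closed≈1 k′ j i d {M = M} n< (ℕₚ.m≤n+m _ _)
  one -[1+ n ] _          = ≡.refl

-- Indexing of the sequence, and the theorem.

-- The division in `G` finds the decomposition with 2 ≤ i ≤ k. An index with i = 1 and j ≥ 1 is
-- therefore found as entry k of the row before, which `row` copies to its entry 1.
G-level : ∀ k → 2 ≤ k → ∀ j i → 1 ≤ i → i ≤ k → ∀ z → G k ((k ∸ 1) ℕ.* j ℕ.+ i) z ≡ level k j i z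
G-level k@(suc (suc k″)) 2≤k@(s≤s (s≤s _)) j (suc (suc i)) _ i≤k z = ≡.cong₂ (λ q m → level k q m z) quotient
    (≡.trans (≡.cong (λ q → (κ ℕ.* j ℕ.+ suc (suc i)) ∸ κ ℕ.* q) quotient) (ℕₚ.m+n∸m≡n (κ ℕ.* j) (suc (suc i))))
  where
  open ≡.≡-Reasoning
  κ : ℕ
  κ = suc k″
  quotient : (κ ℕ.* j ℕ.+ suc (suc i) ∸ 2) / κ ≡ j
  quotient = begin
    (κ ℕ.* j ℕ.+ suc (suc i) ∸ 2) / κ ≡⟨ ≡.cong (_/ κ) (ℕₚ.+-∸-assoc (κ ℕ.* j) {suc (suc i)} (s≤s (s≤s z≤n))) ⟩
    (κ ℕ.* j ℕ.+ i) / κ               ≡⟨ ≡.cong (_/ κ) (≡.trans (≡.cong (ℕ._+ i) (ℕₚ.*-comm κ j)) (ℕₚ.+-comm (j ℕ.* κ) i)) ⟩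
    (i ℕ.+ j ℕ.* κ) / κ               ≡⟨ +-distrib-/-∣ʳ i (divides-refl j) ⟩
    i / κ ℕ.+ j ℕ.* κ / κ             ≡⟨ ≡.cong₂ ℕ._+_ (m<n⇒m/n≡0 (ℕ.s≤s⁻¹ i≤k)) (m*n/n≡m j κ) ⟩
    j                                 ∎
-- For l = 1 no decomposition with i ≥ 2 exists; truncated subtraction makes `l ∸ 2` zero, which
-- still selects row 0.
G-level k@(suc (suc k″)) 2≤k@(s≤s (s≤s _)) zero (suc zero) _ _ z =
  ≡.trans (≡.cong (λ m → G k (m ℕ.+ 1) z) (ℕₚ.*-zeroʳ (suc k″)))
    (≡.cong (λ m → level k 0 (1 ∸ m) z) (ℕₚ.*-zeroʳ (suc k″)))
G-level k@(suc (suc k″)) 2≤k@(s≤s (s≤s _)) (suc j) (suc zero) _ _ z = ≡.trans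
  (≡.cong (λ l → G k l z) (lem k″ j))
  (G-level k 2≤k j k (s≤s z≤n) ℕₚ.≤-refl z)
  where
  lem : ∀ k j → suc k ℕ.* suc j ℕ.+ 1 ≡ suc k ℕ.* j ℕ.+ suc (suc k)
  lem = solve-∀

open import Data.Nat using (_+_; _*_)

theorem4p1 : (k : ℕ) → 2 ≤ k → (j i : ℕ) → 1 ≤ i → i ≤ k →
    ∃[ γ ] ((n : ℤ) →
    G k ((k ∸ 1) * j + i) n ≡ (oneLS +ᴸ shiftL (+ (2 * j + 1)) (fromPS γ)) n)
theorem4p1 k 2≤k j i 1≤i i≤k = γ , λ z → expand z (z ℤ.- + s) ≡.refl
  where
  s : ℕ
  s = 2 * j + 1
  g : LS
  g = G k ((k ∸ 1) * j + i)
  γ : PS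
  -- The coefficients from 2j + 1 on are free, so γ is read off from the series; all content lies in
  -- those below.
  γ n = g (+ (s + n))
  back : ∀ {z y} → z ℤ.- + s ≡ y → z ≡ + s ℤ.+ y
  back {z} ≡.refl = solve 2 (λ s z → z := s :+ (z :- s)) ≡.refl (+ s) z
    where open ℤ-Solver.+-*-Solver
  expand : ∀ z y → z ℤ.- + s ≡ y → g z ≡ oneLS z ℤ.+ fromPS γ y
  -- Writing s as 1 + 2j exposes a successor, so that the coefficient of 1 at s + n computes to 0.
  expand z (+ n) eq with ≡.refl ← back {z} eq = ≡.sym (≡.trans (≡.cong (ℤ._+ γ n) (≡.cong (λ m → onePS (m + n)) (ℕₚ.+-comm (2 * j) 1))) (ℤₚ.+-identityˡ (γ n)))
  expand z -[1+ n ] eq = ≡.trans (G-level k 2≤k j i 1≤i i≤k z)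
    (≡.trans (level≈1 k j 1≤i i≤k z z<s) (≡.sym (ℤₚ.+-identityʳ (oneLS z))))
    where
    z<s : z ℤ.< + suc (2 * j)
    z<s = ≡.subst₂ ℤ._<_ (≡.sym (back {z} eq)) (≡.cong +_ (ℕₚ.+-comm (2 * j) 1))
      (≡.subst (+ s ℤ.+ -[1+ n ] ℤ.<_) (ℤₚ.+-identityʳ (+ s)) (ℤₚ.+-monoʳ-< (+ s) ℤ.-<+))
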